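{- Let $n\ge 3$ and let $K_n\setminus\{e_{1,n}\}$ be the graph obtained from the complete graph $K_n$ on $[n]$ by deleting the edge $\{1,n\}$. For a vertex $r$, let $\mathcal{T}'_r$ be the set of uprooted spanning trees of $K_n\setminus\{e_{1,n}\}$ with root $r$. Then \[|\mathcal{T}'_n| = n^{n-3}(n-2),\] and for $1\le k\le n-2$, \[|\mathcal{T}'_{n-k}| = n^{n-2-k}\,(n-1)^{k-1}\left((n-3-k)+\frac{2nk+n-k-2}{n(n-1)}\right).\]
   Context: An uprooted spanning tree with root $r$ is a spanning tree with distinguished root $r$ in which $r$ is greater than all of its children (i.e., all its neighbours in the tree). -}

module Defs where

open import Data.Bool using (Bool; true; false; _∧_; _∨_; not)
open import Data.Nat using (ℕ; zero; suc; _+_; _*_; _∸_; _≤_; _<ᵇ_; _≡ᵇ_; NonZero; s≤s; z≤n)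
open import Data.List using (List; []; _∷_; map; concatMap; length; filterᵇ; applyUpTo)
open import Data.Bool.ListAction using (any; all)
open import Data.Product using (_×_; _,_)

-- Vertices of K_n are the natural numbers 1,…,n (with their usual order).
-- An edge {i,j} with i < j is represented by the pair (i , j).

Edge : Set
Edge = ℕ × ℕ

vertices : ℕ → List ℕ
vertices n = applyUpTo suc n

edgesKnMinus1n : ℕ → List Edge
edgesKnMinus1n n =
  filterᵇ (λ { (i , j) → (i <ᵇ j) ∧ not ((i ≡ᵇ 1) ∧ (j ≡ᵇ n)) })
          (concatMap (λ i → map (λ j → (i , j)) (vertices n)) (vertices n))

-- all sub-lists (= all subsets, since the edge list has no repetitions)
sublists : {A : Set} → List A → List (List A)
sublists [] = [] ∷ []
sublists (x ∷ xs) = let s = sublists xs in s Data.List.++ map (x ∷_) s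

reachStep : List Edge → (ℕ → Bool) → (ℕ → Bool)
reachStep S R v = R v ∨ any (λ { (a , b) → (R a ∧ (b ≡ᵇ v)) ∨ (R b ∧ (a ≡ᵇ v)) }) S

iterate : ℕ → (ℕ → Bool) → List Edge → (ℕ → Bool)
iterate zero R S = R
iterate (suc m) R S = iterate m (reachStep S R) S

-- vertices reachable from vertex 1 (paths have length < n)
reachableFrom1 : ℕ → List Edge → ℕ → Bool
reachableFrom1 n S = iterate n (λ v → v ≡ᵇ 1) S

isConnected : ℕ → List Edge → Bool
isConnected n S = all (reachableFrom1 n S) (vertices n)

isSpanningTree : ℕ → List Edge → Bool
isSpanningTree n S = isConnected n S ∧ (length S ≡ᵇ (n ∸ 1))

rootAboveNeighbours : ℕ → List Edge → Bool
rootAboveNeighbours r S =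
  all (λ { (a , b) → (not (a ≡ᵇ r) ∨ (b <ᵇ r)) ∧ (not (b ≡ᵇ r) ∨ (a <ᵇ r)) }) S

isUprootedSpanningTree : ℕ → ℕ → List Edge → Bool
isUprootedSpanningTree n r S = isSpanningTree n S ∧ rootAboveNeighbours r S

numUprooted : ℕ → ℕ → ℕ
numUprooted n r = length (filterᵇ (isUprootedSpanningTree n r) (sublists (edgesKnMinus1n n)))

denomNonZero : {n : ℕ} → 3 ≤ n → NonZero (n * (n ∸ 1))
denomNonZero {suc (suc (suc m))} _ = _
denomNonZero {suc (suc zero)} (s≤s (s≤s ()))
denomNonZero {suc zero} (s≤s ())

{-# OPTIONS --safe #-}

-- By double counting, c * τ(f, c) is the sum over the edges of τ of the contraction by that edge,
-- where τ(f, c) counts the spanning trees of the quotient of the graph by the blocks of f.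
-- For the complete graph this recursion is solved by n ^ (c - 1) times the product of the block
-- sizes, which is Cayley's formula for trees containing a given forest. Rooting at r < n upwards
-- means deleting the edges from r to the larger vertices, and deletion-contraction turns Cayley's
-- formula into a count for K_n without a star: contracting a leaf raises the size x of the centre
-- by one, so the formula stays linear in x. The last leaf n and the edge {1, n} are treated by
-- inclusion-exclusion over whether the trees contain {1, n} and {r, n}.

module Submission where

open import Defs
open import Data.Nat using (ℕ; _*_; _^_; _∸_; _≤_)
open import Data.Integer using (+_)
open import Data.Integer as ℤ using ()
open import Data.Rational as ℚ using (ℚ)
open import Data.Product using (_×_)
open import Relation.Binary.PropositionalEquality using (_≡_)
open import Data.Bool using (Bool; true; false; T; not; if_then_else_; _∧_; _∨_)
open import Data.Bool.ListAction using (all; and)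
open import Data.Bool.Properties using (T?; T-∧; T-∨)
open import Data.Empty using (⊥-elim)
open import Data.Integer using (ℤ)
import Data.Integer.Properties as ℤ
import Data.Integer.Tactic.RingSolver as ℤ-solver
open import Data.List using
  (List; []; _∷_; _++_; map; length; filter; filterᵇ; concatMap; applyUpTo
  ; cartesianProduct)
open import Data.List.Membership.DecPropositional using (_∈?_)
open import Data.List.Membership.Propositional using (_∈_; _∉_; find; lose)
open import Data.List.Membership.Propositional.Properties using
  ( ∈-filter⁺; ∈-filter⁻; ∈-map⁺; ∈-map⁻; ∈-concatMap⁺; ∈-concatMap⁻; ∈-++⁺ˡ; ∈-++⁺ʳ; ∈-++⁻
  ; ∈-applyUpTo⁺; ∈-applyUpTo⁻)
open import Data.List.Membership.Propositional.Properties.WithK using (unique∧set⇒bag)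
open import Data.List.Properties using
  (length-++; length-applyUpTo; map-++; map-∘; map-cong; filter-++; filter-all; filter-accept; filter-reject)
open import Data.List.Relation.Binary.BagAndSetEquality using (∼bag⇒↭)
open import Data.List.Relation.Binary.Permutation.Propositional using (_↭_; ↭⇒↭ₛ; ↭-trans; ↭-sym; prep)
import Data.List.Relation.Binary.Permutation.Propositional.Properties as ↭
open import Data.List.Relation.Binary.Permutation.Setoid.Properties using (AllPairs-resp-↭)
open import Data.List.Relation.Unary.All using (All; []; _∷_)
import Data.List.Relation.Unary.All as All
open import Data.List.Relation.Unary.All.Properties using (all⁺; all⁻; ¬Any⇒All¬)
open import Data.List.Relation.Unary.AllPairs using ([]; _∷_)
open import Data.List.Relation.Unary.Any using (here; there)
open import Data.List.Relation.Unary.Any.Properties using (any⁺; any⁻)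
open import Data.List.Relation.Unary.Unique.Propositional using (Unique)
import Data.List.Relation.Unary.Unique.Propositional.Properties as Unique
open import Data.Nat using (zero; suc; _+_; _<_; _≡ᵇ_; _<ᵇ_; _≟_; _<?_; z≤n; s≤s; s≤s⁻¹; NonZero)
open import Data.Nat.ListAction using (sum; product)
open import Data.Nat.ListAction.Properties using (sum-↭; sum-++)
open import Data.Nat.Properties
open import Data.Nat.Tactic.RingSolver using (solve-∀)
open import Data.Product using (_,_; proj₁; proj₂; ∃)
import Data.Rational.Properties as ℚ
open import Data.Rational.Unnormalised as ℚᵘ using (mkℚᵘ; *≡*)
import Data.Rational.Unnormalised.Properties as ℚᵘ
open import Data.Sum using (_⊎_; inj₁; inj₂; [_,_]′)
open import Data.Unit using (⊤; tt)
open import Function using (_∘_; id; _⇔_; Equivalence; mk⇔)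
open import Relation.Binary.PropositionalEquality hiding (_≡_)
open import Relation.Nullary using (¬_; yes; no; contradiction; ¬?)
open import Relation.Nullary.Decidable using (toSum)

open Equivalence using (to; from)

-- Marking an edge only ever contracts, so the induction behind Cayley's formula stays within the
-- complete graph and changes nothing but the partition; plain deletion-contraction would leave that
-- family at the first deletion. For the star it is the other way round: restoring one deleted edge
-- leads to two stars with one leaf fewer, so there deletion-contraction closes up. The star formula
-- needs every leaf to be a block of its own, and contracting {1, n} destroys this for n. Hence only
-- the vertices strictly between r and n serve as leaves, while {1, n} and {r, n} are put back into
-- the edge list and taken out at the very end. Contracted edges may stay in a list as loops, which
-- lets different contractions be counted over one and the same list. Tree counts are compared in ℕ
-- with negative terms moved across; only the final formula passes to ℤ and ℚ.

∑ : {A : Set} → List A → (A → ℕ) → ℕ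
∑ xs g = sum (map g xs)

∑-cong : {A : Set} (xs : List A) {g h : A → ℕ} → (∀ x → g x ≡ h x) → ∑ xs g ≡ ∑ xs h
∑-cong [] eq = refl
∑-cong (x ∷ xs) eq = cong₂ _+_ (eq x) (∑-cong xs eq)

∑-+ : {A : Set} (xs : List A) (g h : A → ℕ) → ∑ xs (λ x → g x + h x) ≡ ∑ xs g + ∑ xs h
∑-+ [] g h = refl
∑-+ (x ∷ xs) g h rewrite ∑-+ xs g h = interchange (g x) (h x) (∑ xs g) (∑ xs h)
  where
  interchange : ∀ a b c d → a + b + (c + d) ≡ a + c + (b + d)
  interchange = solve-∀

∑-*ˡ : {A : Set} (xs : List A) (k : ℕ) (g : A → ℕ) → ∑ xs (λ x → k * g x) ≡ k * ∑ xs g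
∑-*ˡ [] k g = sym (*-zeroʳ k)
∑-*ˡ (x ∷ xs) k g rewrite ∑-*ˡ xs k g = sym (*-distribˡ-+ k (g x) _)

∑-↭ : {A : Set} {xs ys : List A} (g : A → ℕ) → xs ↭ ys → ∑ xs g ≡ ∑ ys g
∑-↭ g p = sum-↭ (↭.map⁺ g p)

-- A labelling of the vertices stands for the partition into its fibres, a forest for the
-- partition into its components.

Labelling : Set
Labelling = ℕ → ℕ

-- Refinement of partitions and contraction of edges

infix 4 _⊑_ _≈_

_⊑_ : Labelling → Labelling → Set
f ⊑ g = ∀ u v → f u ≡ f v → g u ≡ g v

_≈_ : Labelling → Labelling → Set
f ≈ g = f ⊑ g × g ⊑ f

relabel : ℕ → ℕ → ℕ → ℕ
relabel l l′ k with k ≟ l′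
... | yes _ = l
... | no _ = k

infixl 5 _⊕_

-- The merged block keeps the label of the first endpoint, so the centre `r` of a star keeps its
-- label when an edge `(r , l)` is contracted.
_⊕_ : Labelling → Edge → Labelling
(f ⊕ (a , b)) v = relabel (f a) (f b) (f v)

relabel-target : ∀ l l′ → relabel l l′ l′ ≡ l
relabel-target l l′ with l′ ≟ l′
... | yes _ = refl
... | no ≢ = contradiction refl ≢

relabel-other : ∀ l {l′ k} → k ≢ l′ → relabel l l′ k ≡ k
relabel-other l {l′} {k} k≢ with k ≟ l′
... | yes e = contradiction e k≢
... | no _ = refl

relabel-source : ∀ l l′ → relabel l l′ l ≡ l
relabel-source l l′ with l ≟ l′
... | yes _ = refl
... | no _ = refl

⊑-⊕ : ∀ f e → f ⊑ f ⊕ e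
⊑-⊕ f (a , b) u v = cong (relabel (f a) (f b))

Joined : Labelling → Edge → Set
Joined f (a , b) = f a ≡ f b

⊕-joins : ∀ f e → Joined (f ⊕ e) e
⊕-joins f (a , b) = trans (relabel-source (f a) (f b)) (sym (relabel-target (f a) (f b)))

⊕-kernel : ∀ f a b {u v} → (f ⊕ (a , b)) u ≡ (f ⊕ (a , b)) v →
  f u ≡ f v ⊎ (f u ≡ f a × f v ≡ f b) ⊎ (f u ≡ f b × f v ≡ f a)
⊕-kernel f a b {u} {v} eq with f u ≟ f b | f v ≟ f b
... | yes p | yes q = inj₁ (trans p (sym q))
... | yes p | no q = inj₂ (inj₂ (p , sym eq))
... | no p | yes q = inj₂ (inj₁ (eq , q))
... | no p | no q = inj₁ eq

-- With `⊑-⊕` and `⊕-joins` this is the universal property of contraction; monotonicity and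
-- commutation follow from it without computing labels.
⊕-least : ∀ {f g} e → f ⊑ g → Joined g e → f ⊕ e ⊑ g
⊕-least {f} (a , b) f⊑g ab u v eq with ⊕-kernel f a b eq
... | inj₁ p = f⊑g _ _ p
... | inj₂ (inj₁ (p , q)) = trans (f⊑g _ _ p) (trans ab (sym (f⊑g _ _ q)))
... | inj₂ (inj₂ (p , q)) = trans (f⊑g _ _ p) (trans (sym ab) (sym (f⊑g _ _ q)))

⊕-mono : ∀ {f g} e → f ⊑ g → f ⊕ e ⊑ g ⊕ e
⊕-mono {f} {g} e f⊑g = ⊕-least e (λ u v → ⊑-⊕ g e u v ∘ f⊑g u v) (⊕-joins g e)

-- The order of two contractions can affect which label survives, so only the fibres agree; this is
-- why `τ-cong` is stated for `≈`.
⊕-swap : ∀ f e e′ → f ⊕ e ⊕ e′ ⊑ f ⊕ e′ ⊕ e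
⊕-swap f e e′ = ⊕-least e′ (⊕-mono e (⊑-⊕ f e′)) (⊑-⊕ (f ⊕ e′) e _ _ (⊕-joins f e′))

-- The exchange property of the graphic matroid: if `e` becomes a loop only through `e′`, then both
-- edges connect the same two blocks.
joined-exchange : ∀ f e e′ → ¬ Joined f e → Joined (f ⊕ e′) e → Joined (f ⊕ e) e′
joined-exchange f e@(a , b) (a′ , b′) ¬ab ab with ⊕-kernel f a′ b′ ab
... | inj₁ p = contradiction p ¬ab
... | inj₂ (inj₁ (p , q)) = trans (⊑-⊕ f e _ _ (sym p)) (trans (⊕-joins f e) (⊑-⊕ f e _ _ q))
... | inj₂ (inj₂ (p , q)) = trans (⊑-⊕ f e _ _ (sym q)) (trans (sym (⊕-joins f e)) (⊑-⊕ f e _ _ p))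

-- Forests counted by deletion and contraction

δ : ℕ → ℕ → ℕ
δ k l with k ≟ l
... | yes _ = 1
... | no _ = 0

δ-refl : ∀ k → δ k k ≡ 1
δ-refl k with k ≟ k
... | yes _ = refl
... | no ≢ = contradiction refl ≢

δ-≢ : ∀ {k l} → k ≢ l → δ k l ≡ 0
δ-≢ {k} {l} k≢l with k ≟ l
... | yes e = contradiction e k≢l
... | no _ = refl

-- A factor 0 or 1 in place of a case distinction, so that loops drop out of sums by multiplication.
new : Labelling → Edge → ℕ
new f (a , b) = 1 ∸ δ (f a) (f b)

new-joined : ∀ f e → Joined f e → new f e ≡ 0
new-joined f (a , b) ab rewrite ab | δ-refl (f b) = refl

new-unjoined : ∀ f e → ¬ Joined f e → new f e ≡ 1
new-unjoined f (a , b) ¬ab rewrite δ-≢ ¬ab = refl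

joined? : ∀ f e → Joined f e ⊎ ¬ Joined f e
joined? f (a , b) with f a ≟ f b
... | yes p = inj₁ p
... | no p = inj₂ p

new-cong : ∀ {f g} e → f ≈ g → new f e ≡ new g e
new-cong {f} {g} e (f⊑g , g⊑f) with joined? f e
... | inj₁ p = trans (new-joined f e p) (sym (new-joined g e (f⊑g _ _ p)))
... | inj₂ p = trans (new-unjoined f e p) (sym (new-unjoined g e (p ∘ g⊑f _ _)))

-- Either product indicates that the two edges together are acyclic over `f`, a condition symmetric
-- in them.
new-exchange : ∀ f e e′ → new f e′ * new (f ⊕ e′) e ≡ new f e * new (f ⊕ e) e′
new-exchange f e e′ with joined? f e | joined? f e′
... | inj₁ p | inj₁ q rewrite new-joined f e p | new-joined f e′ q = refl
... | inj₁ p | inj₂ q rewrite new-joined f e p | new-joined (f ⊕ e′) e (⊑-⊕ f e′ _ _ p) = *-zeroʳ (new f e′)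
... | inj₂ p | inj₁ q rewrite new-joined f e′ q | new-joined (f ⊕ e) e′ (⊑-⊕ f e _ _ q) = sym (*-zeroʳ (new f e))
... | inj₂ p | inj₂ q rewrite new-unjoined f e p | new-unjoined f e′ q with joined? (f ⊕ e′) e
...   | inj₁ r rewrite new-joined (f ⊕ e′) e r | new-joined (f ⊕ e) e′ (joined-exchange f e e′ p r) = refl
...   | inj₂ r rewrite new-unjoined (f ⊕ e′) e r
                     | new-unjoined (f ⊕ e) e′ (r ∘ joined-exchange f e′ e q) = refl

-- τ f c E counts the c-element subsets of E that are acyclic after contracting the fibres of f.
τ : Labelling → ℕ → List Edge → ℕ
τ f zero E = 1
τ f (suc c) [] = 0
τ f (suc c) (e ∷ E) = τ f (suc c) E + new f e * τ (f ⊕ e) c E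

τ-cong : ∀ {f g} c E → f ≈ g → τ f c E ≡ τ g c E
τ-cong zero E f≈g = refl
τ-cong (suc c) [] f≈g = refl
τ-cong {f} {g} (suc c) (e ∷ E) (f⊑g , g⊑f) = cong₂ _+_ (τ-cong (suc c) E (f⊑g , g⊑f))
  (cong₂ _*_ (new-cong e (f⊑g , g⊑f))
    (τ-cong c E (⊕-mono e f⊑g , ⊕-mono e g⊑f)))

τ-joined : ∀ f c e E → Joined f e → τ f c (e ∷ E) ≡ τ f c E
τ-joined f zero e E p = refl
τ-joined f (suc c) e E p rewrite new-joined f e p = +-identityʳ _

τ-unjoined : ∀ f c e E → ¬ Joined f e → τ f (suc c) (e ∷ E) ≡ τ f (suc c) E + τ (f ⊕ e) c E
τ-unjoined f c e E ¬ab = cong (_+_ (τ f (suc c) E))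
  (trans (cong (_* τ (f ⊕ e) c E) (new-unjoined f e ¬ab)) (*-identityˡ _))

-- Inclusion-exclusion: a forest in `F` avoids both edges or contains one of them, and those
-- containing both are counted twice. The contracted edges stay in `F` as loops, so every term
-- except the first concerns the full list.
τ-without-pair : ∀ f c e e′ E → ¬ Joined f e → ¬ Joined f e′ → ¬ Joined (f ⊕ e) e′ → let F = e ∷ e′ ∷ E in
  τ f (2 + c) E + τ (f ⊕ e) (1 + c) F + τ (f ⊕ e′) (1 + c) F ≡ τ f (2 + c) F + τ (f ⊕ e ⊕ e′) c F
τ-without-pair f c e e′ E ¬e ¬e′ ¬e,e′ = begin
  X + A + τ (f ⊕ e′) (1 + c) (e ∷ e′ ∷ E)     ≡⟨ cong (_+_ (X + A)) via-e′ ⟩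
  X + A + (τ (f ⊕ e′) (1 + c) E + B)          ≡⟨ ring X A (τ (f ⊕ e′) (1 + c) E) B ⟩
  X + τ (f ⊕ e′) (1 + c) E + A + B            ≡⟨ cong₂ _+_ whole via-both ⟨
  τ f (2 + c) (e ∷ e′ ∷ E) + τ (f ⊕ e ⊕ e′) c (e ∷ e′ ∷ E) ∎
  where
  open ≡-Reasoning
  X = τ f (2 + c) E
  A = τ (f ⊕ e) (1 + c) (e ∷ e′ ∷ E)
  B = τ (f ⊕ e ⊕ e′) c E

  ring : ∀ a b x y → a + b + (x + y) ≡ a + x + b + y
  ring = solve-∀

  whole : τ f (2 + c) (e ∷ e′ ∷ E) ≡ X + τ (f ⊕ e′) (1 + c) E + A
  whole = trans (τ-unjoined f (1 + c) e (e′ ∷ E) ¬e)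
    (cong₂ _+_ (τ-unjoined f (1 + c) e′ E ¬e′) (sym (τ-joined (f ⊕ e) (1 + c) e (e′ ∷ E) (⊕-joins f e))))

  via-e′ : τ (f ⊕ e′) (1 + c) (e ∷ e′ ∷ E) ≡ τ (f ⊕ e′) (1 + c) E + B
  via-e′ = trans (τ-unjoined (f ⊕ e′) c e (e′ ∷ E) (¬e,e′ ∘ joined-exchange f e e′ ¬e))
    (cong₂ _+_ (τ-joined (f ⊕ e′) (1 + c) e′ E (⊕-joins f e′))
      (trans (τ-cong c (e′ ∷ E) (⊕-swap f e′ e , ⊕-swap f e e′))
        (τ-joined (f ⊕ e ⊕ e′) c e′ E (⊕-joins (f ⊕ e) e′))))

  via-both : τ (f ⊕ e ⊕ e′) c (e ∷ e′ ∷ E) ≡ B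
  via-both = trans (τ-joined (f ⊕ e ⊕ e′) c e (e′ ∷ E) (⊑-⊕ (f ⊕ e) e′ _ _ (⊕-joins f e)))
    (τ-joined (f ⊕ e ⊕ e′) c e′ E (⊕-joins (f ⊕ e) e′))

-- Choose a forest and one of its edges.
τ-mark : ∀ f c E → suc c * τ f (suc c) E ≡ ∑ E λ e → new f e * τ (f ⊕ e) c E
τ-mark f c [] = *-zeroʳ (suc c)
τ-mark f c (e ∷ E) = begin
  suc c * (K + N * U)                                 ≡⟨ split c K (N * U) ⟩
  N * U + (suc c * K + c * (N * U))
    ≡⟨ cong₂ _+_ (cong (N *_) (sym (τ-joined (f ⊕ e) c e E (⊕-joins f e)))) rest ⟩
  N * τ (f ⊕ e) c (e ∷ E) + ∑ E (λ e′ → new f e′ * τ (f ⊕ e′) c (e ∷ E)) ∎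
  where
  open ≡-Reasoning
  K = τ f (suc c) E
  N = new f e
  U = τ (f ⊕ e) c E

  split : ∀ c t u → suc c * (t + u) ≡ u + (suc c * t + c * u)
  split = solve-∀

  -- Marked edge `e′` in the tail: the forest avoids `e`, or it contains `e` and the two
  -- contractions are interchanged so that `e` comes first.
  second : ∀ c e′ → new f e′ * τ (f ⊕ e′) (suc c) (e ∷ E)
    ≡ new f e′ * τ (f ⊕ e′) (suc c) E + N * (new (f ⊕ e) e′ * τ (f ⊕ e ⊕ e′) c E)
  second c e′ = begin
    new f e′ * (τ (f ⊕ e′) (suc c) E + new (f ⊕ e′) e * τ (f ⊕ e′ ⊕ e) c E)
      ≡⟨ *-distribˡ-+ (new f e′) _ _ ⟩
    new f e′ * τ (f ⊕ e′) (suc c) E + new f e′ * (new (f ⊕ e′) e * τ (f ⊕ e′ ⊕ e) c E)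
      ≡⟨ cong (_+_ (new f e′ * τ (f ⊕ e′) (suc c) E)) (begin
        new f e′ * (new (f ⊕ e′) e * τ (f ⊕ e′ ⊕ e) c E) ≡⟨ *-assoc (new f e′) _ _ ⟨
        new f e′ * new (f ⊕ e′) e * τ (f ⊕ e′ ⊕ e) c E
          ≡⟨ cong₂ _*_ (new-exchange f e e′) (τ-cong c E (⊕-swap f e′ e , ⊕-swap f e e′)) ⟩
        N * new (f ⊕ e) e′ * τ (f ⊕ e ⊕ e′) c E ≡⟨ *-assoc N _ _ ⟩
        N * (new (f ⊕ e) e′ * τ (f ⊕ e ⊕ e′) c E) ∎) ⟩
    new f e′ * τ (f ⊕ e′) (suc c) E + N * (new (f ⊕ e) e′ * τ (f ⊕ e ⊕ e′) c E) ∎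

  -- A forest with `c + 1` edges through `e` has `c` further edges that can be marked. For `c = 0`
  -- both sides are the sum of `new f` over `E`, since the empty forest is counted once in any list.
  rest′ : ∀ c → c * (N * τ (f ⊕ e) c E) + ∑ E (λ e′ → new f e′ * τ (f ⊕ e′) c E)
    ≡ ∑ E (λ e′ → new f e′ * τ (f ⊕ e′) c (e ∷ E))
  rest′ zero = refl
  rest′ (suc c) = begin
    suc c * (N * τ (f ⊕ e) (suc c) E) + ∑ E (λ e′ → new f e′ * τ (f ⊕ e′) (suc c) E)
      ≡⟨ +-comm _ (∑ E _) ⟩
    ∑ E (λ e′ → new f e′ * τ (f ⊕ e′) (suc c) E) + suc c * (N * τ (f ⊕ e) (suc c) E)
      ≡⟨ cong (_+_ (∑ E (λ e′ → new f e′ * τ (f ⊕ e′) (suc c) E))) (begin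
        suc c * (N * τ (f ⊕ e) (suc c) E) ≡⟨ swap (suc c) N _ ⟩
        N * (suc c * τ (f ⊕ e) (suc c) E) ≡⟨ cong (N *_) (τ-mark (f ⊕ e) c E) ⟩
        N * ∑ E (λ e′ → new (f ⊕ e) e′ * τ (f ⊕ e ⊕ e′) c E) ≡⟨ ∑-*ˡ E N _ ⟨
        ∑ E (λ e′ → N * (new (f ⊕ e) e′ * τ (f ⊕ e ⊕ e′) c E)) ∎) ⟩
    ∑ E (λ e′ → new f e′ * τ (f ⊕ e′) (suc c) E) + ∑ E (λ e′ → N * (new (f ⊕ e) e′ * τ (f ⊕ e ⊕ e′) c E))
      ≡⟨ ∑-+ E _ _ ⟨
    ∑ E (λ e′ → new f e′ * τ (f ⊕ e′) (suc c) E + N * (new (f ⊕ e) e′ * τ (f ⊕ e ⊕ e′) c E))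
      ≡⟨ ∑-cong E (λ e′ → sym (second c e′)) ⟩
    ∑ E (λ e′ → new f e′ * τ (f ⊕ e′) (suc c) (e ∷ E)) ∎
    where
    swap : ∀ a b c → a * (b * c) ≡ b * (a * c)
    swap = solve-∀

  rest : suc c * K + c * (N * U) ≡ ∑ E (λ e′ → new f e′ * τ (f ⊕ e′) c (e ∷ E))
  rest = trans (+-comm (suc c * K) _) (trans (cong (_+_ (c * (N * U))) (τ-mark f c E)) (rest′ c))

-- The recursion of `τ` consumes the edges in list order, but the marked count is a sum over the
-- list and therefore symmetric; the factor `suc c` cancels.
τ-↭ : ∀ f c {E E′} → E ↭ E′ → τ f c E ≡ τ f c E′
τ-↭ f zero p = refl
τ-↭ f (suc c) {E} {E′} p = *-cancelˡ-≡ _ _ (suc c) (begin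
  suc c * τ f (suc c) E                    ≡⟨ τ-mark f c E ⟩
  ∑ E (λ e → new f e * τ (f ⊕ e) c E)      ≡⟨ ∑-cong E (λ e → cong (new f e *_) (τ-↭ (f ⊕ e) c p)) ⟩
  ∑ E (λ e → new f e * τ (f ⊕ e) c E′)     ≡⟨ ∑-↭ _ p ⟩
  ∑ E′ (λ e → new f e * τ (f ⊕ e) c E′)    ≡⟨ τ-mark f c E′ ⟨
  suc c * τ f (suc c) E′                   ∎)
  where open ≡-Reasoning

-- Sums and products over block labels

∑-cong-∈ : {A : Set} (xs : List A) {g h : A → ℕ} → (∀ {x} → x ∈ xs → g x ≡ h x) → ∑ xs g ≡ ∑ xs h
∑-cong-∈ [] eq = refl
∑-cong-∈ (x ∷ xs) eq = cong₂ _+_ (eq (here refl)) (∑-cong-∈ xs (eq ∘ there))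

∑-const : {A : Set} (xs : List A) (k : ℕ) → ∑ xs (λ _ → k) ≡ length xs * k
∑-const [] k = refl
∑-const (x ∷ xs) k = cong (_+_ k) (∑-const xs k)

∑-swap : {A B : Set} (xs : List A) (ys : List B) (g : A → B → ℕ) →
  ∑ xs (λ x → ∑ ys (g x)) ≡ ∑ ys (λ y → ∑ xs (λ x → g x y))
∑-swap [] ys g = sym (trans (∑-const ys 0) (*-zeroʳ (length ys)))
∑-swap (x ∷ xs) ys g = trans (cong (_+_ (∑ ys (g x))) (∑-swap xs ys g)) (sym (∑-+ ys (g x) _))

∑-filterᵇ : {A : Set} (p : A → Bool) (xs : List A) (g : A → ℕ) →
  ∑ (filterᵇ p xs) g ≡ ∑ xs (λ x → if p x then g x else 0)
∑-filterᵇ p [] g = refl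
∑-filterᵇ p (x ∷ xs) g with p x
... | true = cong (_+_ (g x)) (∑-filterᵇ p xs g)
... | false = ∑-filterᵇ p xs g

∑-concatMap : {A B : Set} (k : A → List B) (xs : List A) (g : B → ℕ) →
  ∑ (concatMap k xs) g ≡ ∑ xs (λ x → ∑ (k x) g)
∑-concatMap k [] g = refl
∑-concatMap k (x ∷ xs) g = begin
  sum (map g (k x ++ concatMap k xs))             ≡⟨ cong sum (map-++ g (k x) _) ⟩
  sum (map g (k x) ++ map g (concatMap k xs))     ≡⟨ sum-++ (map g (k x)) _ ⟩
  ∑ (k x) g + ∑ (concatMap k xs) g                ≡⟨ cong (_+_ (∑ (k x) g)) (∑-concatMap k xs g) ⟩
  ∑ (k x) g + ∑ xs (λ x → ∑ (k x) g)              ∎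
  where open ≡-Reasoning

∑-δ : ∀ {ls l} (g : ℕ → ℕ) → Unique ls → l ∈ ls → ∑ ls (λ k → δ k l * g k) ≡ g l
∑-δ-∉ : ∀ {ls l} (g : ℕ → ℕ) → All (l ≢_) ls → ∑ ls (λ k → δ k l * g k) ≡ 0
∑-δ-∉ g [] = refl
∑-δ-∉ g (l≢ ∷ l∉) rewrite δ-≢ (l≢ ∘ sym) = ∑-δ-∉ g l∉
∑-δ {l ∷ ls} g (l∉ ∷ u) (here refl) rewrite δ-refl l | ∑-δ-∉ {ls} g l∉ = trans (+-identityʳ _) (+-identityʳ _)
∑-δ {k ∷ ls} g (k∉ ∷ u) (there l∈) rewrite δ-≢ (All.lookup k∉ l∈) = ∑-δ g u l∈

∏ : {A : Set} → List A → (A → ℕ) → ℕ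
∏ xs g = product (map g xs)

∏-cong-∈ : {A : Set} (xs : List A) {g h : A → ℕ} → (∀ {x} → x ∈ xs → g x ≡ h x) → ∏ xs g ≡ ∏ xs h
∏-cong-∈ [] eq = refl
∏-cong-∈ (x ∷ xs) eq = cong₂ _*_ (eq (here refl)) (∏-cong-∈ xs (eq ∘ there))

-- The value 1 at `l` takes one factor out of a product over distinct labels, in place of a
-- division.
except : ℕ → (ℕ → ℕ) → ℕ → ℕ
except l g k with k ≟ l
... | yes _ = 1
... | no _ = g k

except-refl : ∀ l g → except l g l ≡ 1
except-refl l g with l ≟ l
... | yes _ = refl
... | no ≢ = contradiction refl ≢

except-≢ : ∀ {l k} g → k ≢ l → except l g k ≡ g k
except-≢ {l} {k} g k≢l with k ≟ l
... | yes e = contradiction e k≢l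
... | no _ = refl

∏-except : ∀ {ls l} g → Unique ls → l ∈ ls → ∏ ls g ≡ g l * ∏ ls (except l g)
∏-except {l ∷ ls} g (l∉ ∷ u) (here refl) rewrite except-refl l g = cong (g l *_)
  (sym (trans (+-identityʳ _) (∏-cong-∈ ls λ k∈ → except-≢ g (All.lookup l∉ k∈ ∘ sym))))
∏-except {k ∷ ls} {l} g (k∉ ∷ u) (there l∈) rewrite except-≢ g (All.lookup k∉ l∈) | ∏-except g u l∈ =
  swap (g k) (g l) _
  where
  swap : ∀ a b c → a * (b * c) ≡ b * (a * c)
  swap = solve-∀

remove : ℕ → List ℕ → List ℕ
remove l = filter (λ k → ¬? (k ≟ l))

remove-≡ : ∀ l ls → remove l (l ∷ ls) ≡ remove l ls
remove-≡ l ls = filter-reject (λ k → ¬? (k ≟ l)) (λ ≢ → ≢ refl)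

remove-≢ : ∀ {k l} ls → k ≢ l → remove l (k ∷ ls) ≡ k ∷ remove l ls
remove-≢ {l = l} ls k≢l = filter-accept (λ k → ¬? (k ≟ l)) k≢l

∏-remove : ∀ l ls g → ∏ (remove l ls) g ≡ ∏ ls (except l g)
∏-remove l [] g = refl
∏-remove l (k ∷ ls) g with toSum (k ≟ l)
... | inj₁ refl = trans (cong (λ ms → ∏ ms g) (remove-≡ l ls)) (trans (∏-remove l ls g)
  (sym (trans (cong (_* ∏ ls (except l g)) (except-refl l g)) (*-identityˡ _))))
... | inj₂ k≢l = trans (cong (λ ms → ∏ ms g) (remove-≢ ls k≢l))
  (cong₂ _*_ (sym (except-≢ g k≢l)) (∏-remove l ls g))

remove-∉ : ∀ {l ls} → All (l ≢_) ls → remove l ls ≡ ls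
remove-∉ l∉ = filter-all _ (All.map (_∘ sym) l∉)

length-remove : ∀ {l ls} → Unique ls → l ∈ ls → suc (length (remove l ls)) ≡ length ls
length-remove {l} {_ ∷ ls} (l∉ ∷ u) (here refl) = cong (suc ∘ length) (trans (remove-≡ l ls) (remove-∉ l∉))
length-remove {l} {_ ∷ ls} (k∉ ∷ u) (there l∈) =
  cong suc (trans (cong length (remove-≢ ls (All.lookup k∉ l∈))) (length-remove u l∈))

-- Block sizes and Cayley's formula

module _ (V : List ℕ) where

  size : Labelling → ℕ → ℕ
  size f l = ∑ V (λ v → δ l (f v))

  -- A listed label may have an empty fibre, and then has size 0. The converse inclusion is `Hit`,
  -- which is added where trees are counted.
  record Blocks (f : Labelling) (ls : List ℕ) : Set where
    field
      unique : Unique ls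
      cover : ∀ {v} → v ∈ V → f v ∈ ls

  open Blocks public

  ∑-by-blocks : ∀ {f ls} (g : ℕ → ℕ) → Blocks f ls → ∑ V (g ∘ f) ≡ ∑ ls (λ l → size f l * g l)
  ∑-by-blocks {f} {ls} g B = begin
    ∑ V (g ∘ f)                                    ≡⟨ ∑-cong-∈ V (λ v∈ → ∑-δ g (unique B) (cover B v∈)) ⟨
    ∑ V (λ v → ∑ ls (λ l → δ l (f v) * g l))       ≡⟨ ∑-swap V ls _ ⟩
    ∑ ls (λ l → ∑ V (λ v → δ l (f v) * g l))
      ≡⟨ ∑-cong ls (λ l → trans (∑-cong V (λ v → *-comm (δ l (f v)) (g l)))
          (trans (∑-*ˡ V (g l) _) (*-comm (g l) _))) ⟩
    ∑ ls (λ l → size f l * g l)                    ∎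
    where open ≡-Reasoning

  ∑-size : ∀ {f ls} → Blocks f ls → ∑ ls (size f) ≡ length V
  ∑-size {f} {ls} B = begin
    ∑ ls (size f)                   ≡⟨ ∑-cong ls (λ l → *-identityʳ _) ⟨
    ∑ ls (λ l → size f l * 1)       ≡⟨ ∑-by-blocks (λ _ → 1) B ⟨
    ∑ V (λ _ → 1)                   ≡⟨ ∑-const V 1 ⟩
    length V * 1                    ≡⟨ *-identityʳ _ ⟩
    length V                        ∎
    where open ≡-Reasoning

  module _ (f : Labelling) (a b : ℕ) (¬ab : f a ≢ f b) where

    size-⊕-source : size (f ⊕ (a , b)) (f a) ≡ size f (f a) + size f (f b)
    size-⊕-source = trans (∑-cong V (λ v → relabelled (f v))) (∑-+ V _ _)
      where
      relabelled : ∀ k → δ (f a) (relabel (f a) (f b) k) ≡ δ (f a) k + δ (f b) k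
      relabelled k with k ≟ f b
      ... | yes refl rewrite δ-refl (f a) | δ-refl k | δ-≢ ¬ab = refl
      ... | no k≢ rewrite δ-≢ (k≢ ∘ sym) = sym (+-identityʳ _)

    size-⊕-other : ∀ {k} → k ≢ f a → k ≢ f b → size (f ⊕ (a , b)) k ≡ size f k
    size-⊕-other {k} k≢a k≢b = ∑-cong V (λ v → relabelled (f v))
      where
      relabelled : ∀ m → δ k (relabel (f a) (f b) m) ≡ δ k m
      relabelled m with m ≟ f b
      ... | yes refl rewrite δ-≢ k≢a | δ-≢ k≢b = refl
      ... | no _ = refl

    blocks-⊕ : ∀ {ls} → a ∈ V → Blocks f ls → Blocks (f ⊕ (a , b)) (remove (f b) ls)
    blocks-⊕ a∈ B .unique = Unique.filter⁺ _ (unique B)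
    blocks-⊕ {ls} a∈ B .cover {v} v∈ with f v ≟ f b
    ... | yes _ = ∈-filter⁺ (λ k → ¬? (k ≟ f b)) (cover B a∈) ¬ab
    ... | no ¬vb = ∈-filter⁺ (λ k → ¬? (k ≟ f b)) (cover B v∈) ¬vb

    ∏-size-⊕ : ∀ {ls} → a ∈ V → Blocks f ls →
      ∏ (remove (f b) ls) (size (f ⊕ (a , b)))
        ≡ (size f (f a) + size f (f b)) * ∏ ls (except (f a) (except (f b) (size f)))
    ∏-size-⊕ {ls} a∈ B = begin
      ∏ (remove (f b) ls) s′                      ≡⟨ ∏-remove (f b) ls s′ ⟩
      ∏ ls (except (f b) s′)                      ≡⟨ ∏-except (except (f b) s′) (unique B) (cover B a∈) ⟩
      except (f b) s′ (f a) * ∏ ls (except (f a) (except (f b) s′))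
        ≡⟨ cong₂ _*_ (trans (except-≢ s′ ¬ab) size-⊕-source) (∏-cong-∈ ls (λ {k} _ → agree k)) ⟩
      (size f (f a) + size f (f b)) * ∏ ls (except (f a) (except (f b) (size f))) ∎
      where
      open ≡-Reasoning
      s′ = size (f ⊕ (a , b))
      agree : ∀ k → except (f a) (except (f b) s′) k ≡ except (f a) (except (f b) (size f)) k
      agree k with k ≟ f a
      ... | yes _ = refl
      ... | no k≢a with k ≟ f b
      ...   | yes _ = refl
      ...   | no k≢b = size-⊕-other k≢a k≢b

  pairs : List Edge
  pairs = concatMap (λ i → map (λ j → (i , j)) V) V

  complete : List Edge
  complete = filterᵇ (λ { (i , j) → i <ᵇ j }) pairs

  ∑-pairs : (h : Edge → ℕ) → ∑ pairs h ≡ ∑ V (λ a → ∑ V (λ b → h (a , b)))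
  ∑-pairs h = trans (∑-concatMap (λ i → map (λ j → (i , j)) V) V h) (∑-cong V (λ a → cong sum (sym (map-∘ V))))

  ∈-pairs⁻ : ∀ {a b} → (a , b) ∈ pairs → a ∈ V × b ∈ V
  ∈-pairs⁻ ab∈ with find (∈-concatMap⁻ (λ i → map (λ j → (i , j)) V) ab∈)
  ... | (i , i∈ , ab∈′) with ∈-map⁻ (λ j → (i , j)) ab∈′
  ...   | (j , j∈ , refl) = i∈ , j∈

  ∈-pairs⁺ : ∀ {a b} → a ∈ V → b ∈ V → (a , b) ∈ pairs
  ∈-pairs⁺ a∈ b∈ = ∈-concatMap⁺ (λ i → map (λ j → (i , j)) V) (lose a∈ (∈-map⁺ _ b∈))

  pairs-unique : Unique V → Unique pairs
  pairs-unique u = subst Unique (cartesian V) (Unique.cartesianProduct⁺ u u)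
    where
    cartesian : ∀ W → cartesianProduct W V ≡ concatMap (λ i → map (λ j → (i , j)) V) W
    cartesian [] = refl
    cartesian (w ∷ W) = cong (map (w ,_) V ++_) (cartesian W)

  -- Each edge appears as two ordered pairs, and sums over ordered pairs are the ones that can be
  -- regrouped by blocks.
  ∑-complete : (h : ℕ → ℕ → ℕ) → (∀ a → h a a ≡ 0) → (∀ a b → h a b ≡ h b a) →
    2 * ∑ complete (λ { (a , b) → h a b }) ≡ ∑ V (λ a → ∑ V (h a))
  ∑-complete h h-diag h-sym = begin
    2 * S                                                      ≡⟨ double S ⟩
    S + S                                                      ≡⟨ cong₂ _+_ S≡ (trans S≡ (∑-swap V V up)) ⟩
    ∑ V (λ a → ∑ V (up a)) + ∑ V (λ a → ∑ V (λ b → up b a))    ≡⟨ ∑-+ V _ _ ⟨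
    ∑ V (λ a → ∑ V (up a) + ∑ V (λ b → up b a))                ≡⟨ ∑-cong V (λ a → ∑-+ V _ _) ⟨
    ∑ V (λ a → ∑ V (λ b → up a b + up b a))                    ≡⟨ ∑-cong V (λ a → ∑-cong V (up-sym a)) ⟩
    ∑ V (λ a → ∑ V (h a))                                      ∎
    where
    open ≡-Reasoning
    S = ∑ complete (λ { (a , b) → h a b })

    up : ℕ → ℕ → ℕ
    up a b = if a <ᵇ b then h a b else 0

    double : ∀ x → 2 * x ≡ x + x
    double = solve-∀

    S≡ : S ≡ ∑ V (λ a → ∑ V (up a))
    S≡ = trans (∑-filterᵇ _ pairs _) (∑-pairs _)

    up-sym : ∀ a b → up a b + up b a ≡ h a b
    up-sym a b with a <ᵇ b in p | b <ᵇ a in q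
    ... | true | true = contradiction (<ᵇ⇒< b a (subst T (sym q) _)) (<-asym (<ᵇ⇒< a b (subst T (sym p) _)))
    ... | true | false = +-identityʳ _
    ... | false | true = h-sym b a
    ... | false | false with refl ← ≤-antisym {a} {b} (≮⇒≥ (λ b<a → subst T q (<⇒<ᵇ b<a)))
        (≮⇒≥ (λ a<b → subst T p (<⇒<ᵇ a<b))) = sym (h-diag a)

  -- Marking an edge of the tree: there are x * y edges between blocks of sizes x and y, and merging
  -- the two replaces the factor x * y of the product by x + y.
  cayley : ∀ f c {ls} → Blocks f ls → length ls ≡ suc c →
    length V * τ f c complete ≡ length V ^ c * ∏ ls (size f)
  cayley f zero {l ∷ []} B refl = begin
    length V * 1                    ≡⟨ cong (_* 1) (∑-size B) ⟨
    (size f l + 0) * 1              ≡⟨ ring (size f l) ⟩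
    1 * (size f l * 1)              ∎
    where
    open ≡-Reasoning
    ring : ∀ x → (x + 0) * 1 ≡ 1 * (x * 1)
    ring = solve-∀
  -- The factor `suc c` pays for the marked edge, the factor 2 for the passage to ordered pairs.
  cayley f (suc c) {ls} B |ls| = *-cancelˡ-≡ _ _ (2 * suc c) (begin
    2 * suc c * (n * τ f (suc c) complete)           ≡⟨ r₁ (suc c) n _ ⟩
    2 * (n * (suc c * τ f (suc c) complete))         ≡⟨ cong (λ z → 2 * (n * z)) (τ-mark f c complete) ⟩
    2 * (n * ∑ complete (λ e → new f e * τ (f ⊕ e) c complete))
      ≡⟨ cong (2 *_) (∑-*ˡ complete n _) ⟨
    2 * ∑ complete (λ e → n * (new f e * τ (f ⊕ e) c complete))
      ≡⟨ cong (2 *_) (∑-cong-∈ complete first-edge) ⟩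
    2 * ∑ complete (λ { (a , b) → n ^ c * G (f a) (f b) })
      ≡⟨ ∑-complete (λ a b → n ^ c * G (f a) (f b))
          (λ a → trans (cong (n ^ c *_) (G-diag (f a))) (*-zeroʳ (n ^ c)))
              (λ a b → cong (n ^ c *_) (G-sym (f a) (f b))) ⟩
    ∑ V (λ a → ∑ V (λ b → n ^ c * G (f a) (f b)))
      ≡⟨ ∑-by-blocks (λ l → ∑ V (λ b → n ^ c * G l (f b))) B ⟩
    ∑ ls (λ l → s l * ∑ V (λ b → n ^ c * G l (f b)))
      ≡⟨ ∑-cong ls (λ l → cong (s l *_) (∑-by-blocks (λ l′ → n ^ c * G l l′) B)) ⟩
    ∑ ls (λ l → s l * ∑ ls (λ l′ → s l′ * (n ^ c * G l l′)))
      ≡⟨ ∑-cong ls (λ l → ∑-*ˡ ls (s l) _) ⟨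
    ∑ ls (λ l → ∑ ls (λ l′ → s l * (s l′ * (n ^ c * G l l′))))
      ≡⟨ ∑-cong-∈ ls (λ l∈ → ∑-cong-∈ ls (λ l′∈ → merge-pair l∈ l′∈)) ⟩
    ∑ ls (λ l → ∑ ls (λ l′ → n ^ c * W * (ne l l′ * (s l + s l′))))
      ≡⟨ ∑-cong ls (λ l → ∑-*ˡ ls (n ^ c * W) _) ⟩
    ∑ ls (λ l → n ^ c * W * ∑ ls (λ l′ → (ne l l′ * (s l + s l′))))
      ≡⟨ ∑-*ˡ ls (n ^ c * W) _ ⟩
    n ^ c * W * ∑ ls (λ l → ∑ ls (λ l′ → (ne l l′ * (s l + s l′))))
      ≡⟨ cong (n ^ c * W *_) off-diagonal ⟩
    n ^ c * W * (2 * suc c * n)                 ≡⟨ r₂ (n ^ c) W (2 * suc c) n ⟩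
    2 * suc c * (n ^ suc c * W)                 ∎)
    where
    open ≡-Reasoning
    n = length V
    s = size f
    W = ∏ ls s

    ne : ℕ → ℕ → ℕ
    ne l l′ = 1 ∸ δ l l′

    G : ℕ → ℕ → ℕ
    G l l′ = ne l l′ * ((s l + s l′) * ∏ ls (except l (except l′ s)))

    G-diag : ∀ l → G l l ≡ 0
    G-diag l rewrite δ-refl l = refl

    G-sym : ∀ l l′ → G l l′ ≡ G l′ l
    G-sym l l′ = cong₂ _*_ ne-sym (cong₂ _*_ (+-comm (s l) (s l′)) (∏-cong-∈ ls (λ {k} _ → except-comm k)))
      where
      ne-sym : ne l l′ ≡ ne l′ l
      ne-sym with l ≟ l′
      ... | yes refl rewrite δ-refl l = refl
      ... | no l≢l′ rewrite δ-≢ (l≢l′ ∘ sym) = refl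
      except-comm : ∀ k → except l (except l′ s) k ≡ except l′ (except l s) k
      except-comm k with k ≟ l
      ... | no k≢l with k ≟ l′
      ...   | yes _ = refl
      ...   | no _ = sym (except-≢ s k≢l)
      except-comm k | yes refl with k ≟ l′
      ...   | yes _ = refl
      ...   | no _ = sym (except-refl k s)

    r₁ : ∀ a b t → 2 * a * (b * t) ≡ 2 * (b * (a * t))
    r₁ = solve-∀
    r₂ : ∀ p w k n → p * w * (k * n) ≡ k * (n * p * w)
    r₂ = solve-∀

    first-edge : ∀ {e} → e ∈ complete → n * (new f e * τ (f ⊕ e) c complete) ≡ n ^ c * G (f (proj₁ e)) (f (proj₂ e))
    first-edge {e@(a , b)} e∈ with joined? f e
    ... | inj₁ ab rewrite ab | δ-refl (f b) = trans (*-zeroʳ n) (sym (*-zeroʳ (n ^ c)))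
    ... | inj₂ ¬ab with a∈ , b∈ ← ∈-pairs⁻ (proj₁ (∈-filter⁻ _ {xs = pairs} e∈)) rewrite δ-≢ ¬ab = begin
      n * (1 * τ (f ⊕ e) c complete)   ≡⟨ cong (n *_) (*-identityˡ _) ⟩
      n * τ (f ⊕ e) c complete
        ≡⟨ cayley (f ⊕ e) c (blocks-⊕ f a b ¬ab a∈ B)
            (suc-injective (trans (length-remove (unique B) (cover B b∈)) |ls|)) ⟩
      n ^ c * ∏ (remove (f b) ls) (size (f ⊕ e))
        ≡⟨ cong (n ^ c *_) (trans (∏-size-⊕ f a b ¬ab a∈ B) (sym (*-identityˡ _))) ⟩
      n ^ c * (1 * ((s (f a) + s (f b)) * ∏ ls (except (f a) (except (f b) s)))) ∎

    -- The weights `s l` and `s l′`, which count vertex pairs between the two blocks, restore the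
    -- two factors missing from the product.
    merge-pair : ∀ {l l′} → l ∈ ls → l′ ∈ ls → s l * (s l′ * (n ^ c * G l l′)) ≡ n ^ c * W * (ne l l′ * (s l + s l′))
    merge-pair {l} {l′} l∈ l′∈ with l ≟ l′
    ... | yes refl = r₃ (s l) (n ^ c) W
      where
      r₃ : ∀ x p w → x * (x * (p * 0)) ≡ p * w * 0
      r₃ = solve-∀
    ... | no l≢l′ = trans (r₄ (s l) (s l′) (n ^ c) (s l + s l′) (∏ ls (except l (except l′ s))))
        (cong (λ w → n ^ c * w * (1 * (s l + s l′))) (sym W-split))
      where
      r₄ : ∀ x y p t q → x * (y * (p * (1 * (t * q)))) ≡ p * (y * (x * q)) * (1 * t)
      r₄ = solve-∀
      W-split : W ≡ s l′ * (s l * ∏ ls (except l (except l′ s)))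
      W-split = trans (∏-except s (unique B) l′∈) (cong (s l′ *_)
        (trans (∏-except (except l′ s) (unique B) l∈) (cong (_* ∏ ls (except l (except l′ s))) (except-≢ s l≢l′))))

    -- With `c + 2` labels the full double sum is 2(c + 2)n, and the diagonal accounts for 2n of it.
    -- The remaining 2(c + 1)n supplies both the factor to be cancelled and one more power of n.
    off-diagonal : ∑ ls (λ l → ∑ ls (λ l′ → ne l l′ * (s l + s l′))) ≡ 2 * suc c * n
    off-diagonal = +-cancelʳ-≡ (n + n) _ _ (begin
      ∑ ls (λ l → ∑ ls (λ l′ → ne l l′ * (s l + s l′))) + (n + n)
        ≡⟨ cong (_+_ (∑ ls (λ l → ∑ ls (λ l′ → ne l l′ * (s l + s l′))))) diagonal ⟨
      ∑ ls (λ l → ∑ ls (λ l′ → ne l l′ * (s l + s l′))) + ∑ ls (λ l → ∑ ls (λ l′ → δ l l′ * (s l + s l′)))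
        ≡⟨ trans (∑-cong ls (λ l → ∑-+ ls _ _)) (∑-+ ls _ _) ⟨
      ∑ ls (λ l → ∑ ls (λ l′ → ne l l′ * (s l + s l′) + δ l l′ * (s l + s l′)))
        ≡⟨ ∑-cong ls (λ l → ∑-cong ls (λ l′ → ne+δ l l′ _)) ⟩
      ∑ ls (λ l → ∑ ls (λ l′ → s l + s l′))
        ≡⟨ ∑-cong ls (λ l → trans (∑-+ ls _ _) (cong₂ _+_ (∑-const ls (s l)) (∑-size B))) ⟩
      ∑ ls (λ l → length ls * s l + n)
        ≡⟨ trans (∑-+ ls _ _) (cong₂ _+_ (trans (∑-*ˡ ls (length ls) s) (cong (length ls *_) (∑-size B))) (∑-const ls n)) ⟩
      length ls * n + length ls * n              ≡⟨ cong (λ z → z * n + z * n) |ls| ⟩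
      suc (suc c) * n + suc (suc c) * n          ≡⟨ r₅ (suc c) n ⟩
      2 * suc c * n + (n + n)                    ∎)
      where
      r₅ : ∀ c n → suc c * n + suc c * n ≡ 2 * c * n + (n + n)
      r₅ = solve-∀
      ne+δ : ∀ l l′ t → ne l l′ * t + δ l l′ * t ≡ t
      ne+δ l l′ t with l ≟ l′
      ... | yes _ = +-identityʳ t
      ... | no _ = trans (+-identityʳ _) (+-identityʳ t)
      diagonal : ∑ ls (λ l → ∑ ls (λ l′ → δ l l′ * (s l + s l′))) ≡ n + n
      diagonal = begin
        ∑ ls (λ l → ∑ ls (λ l′ → δ l l′ * (s l + s l′))) ≡⟨ ∑-swap ls ls _ ⟩
        ∑ ls (λ l′ → ∑ ls (λ l → δ l l′ * (s l + s l′)))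
          ≡⟨ ∑-cong-∈ ls (λ {l′} l′∈ → ∑-δ (λ l → s l + s l′) (unique B) l′∈) ⟩
        ∑ ls (λ l′ → s l′ + s l′)                        ≡⟨ ∑-+ ls s s ⟩
        ∑ ls s + ∑ ls s                                  ≡⟨ cong₂ _+_ (∑-size B) (∑-size B) ⟩
        n + n                                            ∎

-- The complete graph without a star

module _ (V : List ℕ) where

  blocks-↭ : ∀ {f ls ls′} → ls ↭ ls′ → Blocks V f ls → Blocks V f ls′
  blocks-↭ p B .unique = AllPairs-resp-↭ (setoid ℕ) (_∘ sym) (subst (_ ≢_) , subst (_≢ _)) (↭⇒↭ₛ p) (unique B)
  blocks-↭ p B .cover v∈ = ↭.∈-resp-↭ p (cover B v∈)

  -- The equation τ = nᴿ⁻¹ mʲ⁻¹ (m x − j) p with n = m + 1, cleared of division and subtraction.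
  deleted-star : ∀ {m r} → length V ≡ suc m → r ∈ V →
    ∀ leaves others f E → map (r ,_) leaves ++ E ↭ complete V →
    Blocks V f (r ∷ leaves ++ others) → f r ≡ r → (∀ {l} → l ∈ leaves → f l ≡ l × size V f l ≡ 1) →
    let R = length others ; j = length leaves ; p = ∏ others (size V f) in
    suc m * m * τ f (j + R) E + suc m ^ R * m ^ j * (j * p) ≡ suc m ^ R * m ^ j * (m * size V f r * p)
  deleted-star {m} {r} |V| r∈ [] others f E perm B fr leaf = begin
    suc m * m * τ f R E + suc m ^ R * 1 * 0      ≡⟨ r₁ (suc m) m (τ f R E) (suc m ^ R) ⟩
    m * (suc m * τ f R E)                        ≡⟨ cong (λ t → m * (suc m * t)) (τ-↭ f R perm) ⟩
    m * (suc m * τ f R (complete V))             ≡⟨ cong (λ n → m * (n * τ f R (complete V))) |V| ⟨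
    m * (length V * τ f R (complete V))          ≡⟨ cong (m *_) (cayley V f R B refl) ⟩
    m * (length V ^ R * (size V f r * p))        ≡⟨ cong (λ n → m * (n ^ R * (size V f r * p))) |V| ⟩
    m * (suc m ^ R * (size V f r * p))           ≡⟨ r₂ m (suc m ^ R) (size V f r) p ⟩
    suc m ^ R * 1 * (m * size V f r * p)         ∎
    where
    open ≡-Reasoning
    R = length others
    p = ∏ others (size V f)
    r₁ : ∀ n m t P → n * m * t + P * 1 * 0 ≡ m * (n * t)
    r₁ = solve-∀
    r₂ : ∀ m P x p → m * (P * (x * p)) ≡ P * 1 * (m * x * p)
    r₂ = solve-∀
  deleted-star {m} {r} |V| r∈ (l ∷ leaves) others f E perm B fr leaf = +-cancelʳ-≡ (Y + a + d) (X + c₁) c₂ (begin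
    X + c₁ + (Y + a + d)      ≡⟨ r₁ X c₁ Y a d ⟩
    X + Y + a + (d + c₁)      ≡⟨ cong (_+ (d + c₁)) kept ⟩
    b + (d + c₁)              ≡⟨ r₂ m (suc m ^ R) (m ^ j) x j p ⟩
    g + (a + c₂)              ≡⟨ cong (_+ (a + c₂)) contracted ⟨
    Y + d + (a + c₂)          ≡⟨ r₃ Y d a c₂ ⟩
    c₂ + (Y + a + d)          ∎)
    where
    open ≡-Reasoning
    e : Edge
    e = r , l
    f′ = f ⊕ e
    R = length others
    j = length leaves
    p = ∏ others (size V f)
    x = size V f r

    fl : f l ≡ l
    fl = proj₁ (leaf (here refl))
    size-l : size V f l ≡ 1
    size-l = proj₂ (leaf (here refl))

    r≢ : All (r ≢_) (l ∷ leaves ++ others)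
    r≢ with r≢ ∷ _ ← unique B = r≢
    l≢ : All (l ≢_) (leaves ++ others)
    l≢ with _ ∷ l≢ ∷ _ ← unique B = l≢
    r≢l : r ≢ l
    r≢l = All.head r≢

    ¬joined : f r ≢ f l
    ¬joined eq = r≢l (trans (sym fr) (trans eq fl))

    perm′ : map (r ,_) leaves ++ e ∷ E ↭ complete V
    perm′ = ↭-trans (↭.shift e (map (r ,_) leaves) E) perm

    X = suc m * m * τ f (suc j + R) E
    Y = suc m * m * τ f′ (j + R) E
    a = suc m ^ suc R * m ^ j * (j * p)
    b = suc m ^ suc R * m ^ j * (m * x * p)
    c₁ = suc m ^ R * m ^ suc j * (suc j * p)
    c₂ = suc m ^ R * m ^ suc j * (m * x * p)
    d = suc m ^ R * m ^ j * (j * p)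
    g = suc m ^ R * m ^ j * (m * suc x * p)

    r₁ : ∀ X c Y a d → X + c + (Y + a + d) ≡ X + Y + a + (d + c)
    r₁ = solve-∀
    -- Up to the common factors this is n(mx - j) - (m(x + 1) - j) = m(mx - (j + 1)) for n = m + 1:
    -- each deleted edge exchanges a power of n for a power of m and raises j by one.
    r₂ : ∀ m P Q x j p → suc m * P * Q * (m * x * p) + (P * Q * (j * p) + P * (m * Q) * (suc j * p))
      ≡ P * Q * (m * suc x * p) + (suc m * P * Q * (j * p) + P * (m * Q) * (m * x * p))
    r₂ = solve-∀
    r₃ : ∀ Y d a c → Y + d + (a + c) ≡ c + (Y + a + d)
    r₃ = solve-∀

    -- Once `e` is restored, the leaf `l` is an ordinary block; its size 1 leaves `p` unchanged
    -- while `R` grows.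
    kept : X + Y + a ≡ b
    kept = begin
      X + Y + a
        ≡⟨ cong (_+ a) (trans (sym (*-distribˡ-+ (suc m * m) (τ f (suc j + R) E) (τ f′ (j + R) E)))
            (cong (suc m * m *_) split)) ⟩
      suc m * m * τ f (suc j + R) (e ∷ E) + a
        ≡⟨ cong₂ (λ k q → suc m * m * τ f k (e ∷ E) + suc m ^ suc R * m ^ j * (j * q)) (sym (+-suc j R)) p≡ ⟩
      suc m * m * τ f (j + suc R) (e ∷ E) + suc m ^ suc R * m ^ j * (j * ∏ (l ∷ others) (size V f))
        ≡⟨ deleted-star |V| r∈ leaves (l ∷ others) f (e ∷ E) perm′
            (blocks-↭ (prep r (↭-sym (↭.shift l leaves others))) B) fr (leaf ∘ there) ⟩
      suc m ^ suc R * m ^ j * (m * x * ∏ (l ∷ others) (size V f))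
        ≡⟨ cong (λ q → suc m ^ suc R * m ^ j * (m * x * q)) p≡ ⟨
      b ∎
      where
      p≡ : p ≡ ∏ (l ∷ others) (size V f)
      p≡ = trans (sym (*-identityˡ p)) (cong (_* p) (sym size-l))
      split : τ f (suc j + R) E + τ f′ (j + R) E ≡ τ f (suc j + R) (e ∷ E)
      split = sym (τ-unjoined f (j + R) e E ¬joined)

    other-fixed : ∀ {k} → k ∈ leaves ++ others → size V f′ k ≡ size V f k
    other-fixed k∈ = size-⊕-other V f r l ¬joined
      (λ eq → All.lookup (All.tail r≢) k∈ (sym (trans eq fr)))
      (λ eq → All.lookup l≢ k∈ (sym (trans eq fl)))

    -- `e` is put back as a loop, so that the remaining leaves and the list again make up the
    -- complete graph.
    contracted : Y + d ≡ g
    contracted = begin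
      Y + d
        ≡⟨ cong₂ (λ t q → suc m * m * t + suc m ^ R * m ^ j * (j * q)) (sym (τ-joined f′ (j + R) e E (⊕-joins f e))) p≡ ⟩
      suc m * m * τ f′ (j + R) (e ∷ E) + suc m ^ R * m ^ j * (j * ∏ others (size V f′))
        ≡⟨ deleted-star |V| r∈ leaves others f′ (e ∷ E) perm′ B′ f′r leaf′ ⟩
      suc m ^ R * m ^ j * (m * size V f′ r * ∏ others (size V f′))
        ≡⟨ cong₂ (λ y q → suc m ^ R * m ^ j * (m * y * q)) x≡ (sym p≡) ⟩
      g ∎
      where
      p≡ : p ≡ ∏ others (size V f′)
      p≡ = ∏-cong-∈ others (λ k∈ → sym (other-fixed (∈-++⁺ʳ leaves k∈)))
      x≡ : size V f′ r ≡ suc x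
      x≡ = begin
        size V f′ r                     ≡⟨ cong (size V f′) fr ⟨
        size V f′ (f r)                 ≡⟨ size-⊕-source V f r l ¬joined ⟩
        size V f (f r) + size V f (f l) ≡⟨ cong₂ (λ y z → size V f y + size V f z) fr fl ⟩
        x + size V f l                  ≡⟨ cong (_+_ x) size-l ⟩
        x + 1                           ≡⟨ +-comm x 1 ⟩
        suc x                           ∎
      B′ : Blocks V f′ (r ∷ leaves ++ others)
      B′ = subst (Blocks V f′)
        (trans (cong (λ k → remove k (r ∷ l ∷ leaves ++ others)) fl)
          (trans (remove-≢ _ r≢l) (cong (r ∷_) (trans (remove-≡ l _) (remove-∉ l≢)))))
        (blocks-⊕ V f r l ¬joined r∈ B)
      f′r : f′ r ≡ r
      f′r = trans (relabel-source (f r) (f l)) fr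
      leaf′ : ∀ {k} → k ∈ leaves → f′ k ≡ k × size V f′ k ≡ 1
      leaf′ k∈ with fk , size-k ← leaf (there k∈) =
        trans (relabel-other (f r) (λ eq → All.lookup l≢ (∈-++⁺ˡ k∈) (trans (sym fl) (trans (sym eq) fk)))) fk ,
        trans (other-fixed (∈-++⁺ˡ k∈)) size-k

-- Spanning trees among the sublists of an edge list

contract : Labelling → List Edge → Labelling
contract f [] = f
contract f (e ∷ S) = contract (f ⊕ e) S

⊑-contract : ∀ f S → f ⊑ contract f S
⊑-contract f [] u v = id
⊑-contract f (e ∷ S) u v = ⊑-contract (f ⊕ e) S u v ∘ ⊑-⊕ f e u v

contract-joins : ∀ f S → All (Joined (contract f S)) S
contract-joins f [] = []
contract-joins f (e ∷ S) = ⊑-contract (f ⊕ e) S _ _ (⊕-joins f e) ∷ contract-joins (f ⊕ e) S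

-- Allows connectedness to be tested against any labelling constant along the edges, in particular
-- against the set of reached vertices.
contract-least : ∀ {f g} S → f ⊑ g → All (Joined g) S → contract f S ⊑ g
contract-least [] f⊑g [] = f⊑g
contract-least (e ∷ S) f⊑g (p ∷ ps) = contract-least S (⊕-least e f⊑g p) ps

count : {A : Set} → (List A → Bool) → List A → ℕ
count p E = length (filterᵇ p (sublists E))

length-filterᵇ-++ : {A : Set} (p : A → Bool) (xs ys : List A) →
  length (filterᵇ p (xs ++ ys)) ≡ length (filterᵇ p xs) + length (filterᵇ p ys)
length-filterᵇ-++ p xs ys = trans (cong length (filter-++ (T? ∘ p) xs ys)) (length-++ (filterᵇ p xs))

length-filterᵇ-map : {A B : Set} (p : B → Bool) (g : A → B) (xs : List A) →
  length (filterᵇ p (map g xs)) ≡ length (filterᵇ (p ∘ g) xs)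
length-filterᵇ-map p g [] = refl
length-filterᵇ-map p g (x ∷ xs) with p (g x)
... | true = cong suc (length-filterᵇ-map p g xs)
... | false = length-filterᵇ-map p g xs

count-∷ : {A : Set} (p : List A → Bool) (e : A) (E : List A) → count p (e ∷ E) ≡ count p E + count (p ∘ (e ∷_)) E
count-∷ p e E = trans (length-filterᵇ-++ p (sublists E) (map (e ∷_) (sublists E)))
  (cong (_+_ (count p E)) (length-filterᵇ-map p (e ∷_) (sublists E)))

count-none : {A : Set} {P : A → Set} (p : List A → Bool) {E : List A} → All P E →
    (∀ S → All P S → ¬ T (p S)) → count p E ≡ 0
count-none p {[]} [] none with p [] | none [] []
... | true | ¬p = contradiction tt ¬p
... | false | _ = refl
count-none p {e ∷ E} (Pe ∷ PE) none = trans (count-∷ p e E)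
  (cong₂ _+_ (count-none p PE none) (count-none (p ∘ (e ∷_)) PE (λ S PS → none (e ∷ S) (Pe ∷ PS))))

count-cong : {A : Set} (p q : List A → Bool) (E : List A) → (∀ S → p S ≡ q S) → count p E ≡ count q E
count-cong p q [] eq rewrite eq [] with q []
... | true = refl
... | false = refl
count-cong p q (e ∷ E) eq = begin
  count p (e ∷ E)                         ≡⟨ count-∷ p e E ⟩
  count p E + count (p ∘ (e ∷_)) E
    ≡⟨ cong₂ _+_ (count-cong p q E eq) (count-cong (p ∘ (e ∷_)) (q ∘ (e ∷_)) E (eq ∘ (e ∷_))) ⟩
  count q E + count (q ∘ (e ∷_)) E        ≡⟨ count-∷ q e E ⟨
  count q (e ∷ E)                         ∎
  where open ≡-Reasoning

-- Turns a set of vertices into a labelling with two values, and its cardinality into a sum.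
bit : Bool → ℕ
bit true = 1
bit false = 0

bit-≡ : ∀ {x y} → (T x → T y) → (T y → T x) → bit x ≡ bit y
bit-≡ {true} {true} _ _ = refl
bit-≡ {true} {false} g _ = ⊥-elim (g tt)
bit-≡ {false} {true} _ h = ⊥-elim (h tt)
bit-≡ {false} {false} _ _ = refl

bit-T : ∀ {x y} → bit x ≡ bit y → T x → T y
bit-T {true} {true} _ _ = tt

module _ (V : List ℕ) where

  Inside : Edge → Set
  Inside (a , b) = a ∈ V × b ∈ V

  Connects : Labelling → List Edge → Set
  Connects f S = ∀ u v → u ∈ V → v ∈ V → contract f S u ≡ contract f S v

  Hit : Labelling → List ℕ → Set
  Hit f ls = ∀ {l} → l ∈ ls → ∃ λ v → v ∈ V × f v ≡ l

  hit-⊕ : ∀ {f ls} e → Hit f ls → Hit (f ⊕ e) (remove (f (proj₂ e)) ls)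
  hit-⊕ {f} (a , b) hit l∈ with l∈ls , l≢ ← ∈-filter⁻ _ l∈ with v , v∈ , refl ← hit l∈ls = v , v∈ , relabel-other (f a) l≢

  length≤1+remove : ∀ {l ls} → Unique ls → length ls ≤ suc (length (remove l ls))
  length≤1+remove {l} {ls} u with _∈?_ _≟_ l ls
  ... | yes l∈ = ≤-reflexive (sym (length-remove u l∈))
  ... | no l∉ = ≤-trans (≤-reflexive (cong length (sym (remove-∉ (¬Any⇒All¬ ls l∉))))) (n≤1+n _)

  -- Each contraction removes at most one label, and a connected contraction ends with at most one.
  labels≤edges : ∀ {f ls} S → Unique ls → Hit f ls → Connects f S → length ls ≤ suc (length S)
  labels≤edges {ls = []} [] u hit conn = z≤n
  labels≤edges {ls = _ ∷ []} [] u hit conn = s≤s z≤n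
  labels≤edges {ls = _ ∷ _ ∷ _} [] ((l≢ ∷ _) ∷ _) hit conn
    with _ , u∈ , refl ← hit (here refl) | _ , v∈ , refl ← hit (there (here refl)) = contradiction (conn _ _ u∈ v∈) l≢
  labels≤edges (e@(a , b) ∷ S) u hit conn =
    ≤-trans (length≤1+remove u) (s≤s (labels≤edges S (Unique.filter⁺ _ u) (hit-⊕ e hit) conn))

  -- For `c + 1` blocks and `c` edges, connected and acyclic mean the same. The predicate `p` is
  -- arbitrary so that the induction can pass to `p ∘ (e ∷_)`; a loop among the `c` edges leaves too
  -- few others to connect the blocks.
  count-trees : ∀ f c {ls} E (p : List Edge → Bool) → Blocks V f ls → Hit f ls → length ls ≡ suc c → All Inside E →
    (∀ S → All Inside S → T (p S) ⇔ (Connects f S × length S ≡ c)) → count p E ≡ τ f c E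
  count-trees f zero {l ∷ []} [] p B hit refl [] spec with p [] | spec [] []
  ... | true | _ = refl
  ... | false | s = ⊥-elim (from s ((λ _ _ u∈ v∈ → same (cover B u∈) (cover B v∈)) , refl))
    where
    same : ∀ {x y} → x ∈ l ∷ [] → y ∈ l ∷ [] → x ≡ y
    same (here p) (here q) = trans p (sym q)
  count-trees f (suc c) [] p B hit |ls| [] spec with p [] | spec [] []
  ... | true | s = contradiction (proj₂ (to s tt)) λ ()
  ... | false | _ = refl
  count-trees f zero (e ∷ E) p B hit |ls| (e∈ ∷ E∈) spec = trans (count-∷ p e E)
    (cong₂ _+_ (count-trees f zero E p B hit |ls| E∈ spec)
      (count-none (p ∘ (e ∷_)) E∈ (λ S S∈ t → contradiction (proj₂ (to (spec (e ∷ S) (e∈ ∷ S∈)) t)) λ ())))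
  count-trees f (suc c) {ls} (e@(a , b) ∷ E) p B hit |ls| (e∈@(a∈ , b∈) ∷ E∈) spec = trans (count-∷ p e E)
    (cong₂ _+_ (count-trees f (suc c) E p B hit |ls| E∈ spec) (with-e (joined? f e)))
    where
    with-e : Joined f e ⊎ ¬ Joined f e → count (p ∘ (e ∷_)) E ≡ new f e * τ (f ⊕ e) c E
    with-e (inj₁ ab) = trans (count-none (p ∘ (e ∷_)) E∈ none) (cong (_* τ (f ⊕ e) c E) (sym (new-joined f e ab)))
      where
      hit′ : Hit (f ⊕ e) ls
      hit′ {l} l∈ with hit l∈
      ... | v , v∈ , refl with f v ≟ f b
      ...   | yes vb = v , v∈ , trans (cong (relabel (f a) (f b)) vb)
          (trans (relabel-target (f a) (f b)) (trans ab (sym vb)))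
      ...   | no ¬vb = v , v∈ , relabel-other (f a) ¬vb
      none : ∀ S → All Inside S → ¬ T (p (e ∷ S))
      none S S∈ t with conn , |S| ← to (spec (e ∷ S) (e∈ ∷ S∈)) t =
        1+n≰n (≤-trans (≤-reflexive (sym |ls|)) (≤-trans (labels≤edges S (unique B) hit′ conn) (≤-reflexive |S|)))
    with-e (inj₂ ¬ab) = begin
      count (p ∘ (e ∷_)) E
        ≡⟨ count-trees (f ⊕ e) c E (p ∘ (e ∷_)) (blocks-⊕ V f a b ¬ab a∈ B) (hit-⊕ e hit)
            (suc-injective (trans (length-remove (unique B) (cover B b∈)) |ls|)) E∈ spec′ ⟩
      τ (f ⊕ e) c E              ≡⟨ *-identityˡ _ ⟨
      1 * τ (f ⊕ e) c E          ≡⟨ cong (_* τ (f ⊕ e) c E) (new-unjoined f e ¬ab) ⟨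
      new f e * τ (f ⊕ e) c E    ∎
      where
      open ≡-Reasoning
      spec′ : ∀ S → All Inside S → T (p (e ∷ S)) ⇔ (Connects (f ⊕ e) S × length S ≡ c)
      spec′ S S∈ = mk⇔
        (λ t → let conn , |S| = to (spec (e ∷ S) (e∈ ∷ S∈)) t in conn , suc-injective |S|)
        (λ { (conn , |S|) → from (spec (e ∷ S) (e∈ ∷ S∈)) (conn , cong suc |S|) })

  -- The reachability search

  module _ (S : List Edge) where

    step-⊇ : ∀ R {v} → T (R v) → T (reachStep S R v)
    step-⊇ R t = from T-∨ (inj₁ t)

    step-→ : ∀ R {a b} → (a , b) ∈ S → T (R a) → T (reachStep S R b)
    step-→ R {a} {b} ab∈ t =
        from (T-∨ {R b}) (inj₂ (any⁺ _ (lose ab∈ (from T-∨ (inj₁ (from T-∧ (t , ≡⇒≡ᵇ b b refl)))))))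

    step-← : ∀ R {a b} → (a , b) ∈ S → T (R b) → T (reachStep S R a)
    step-← R {a} {b} ab∈ t =
        from (T-∨ {R a}) (inj₂ (any⁺ _ (lose ab∈ (from (T-∨ {R a ∧ (b ≡ᵇ a)}) (inj₂ (from T-∧ (t , ≡⇒≡ᵇ a a refl)))))))

    Closed : (ℕ → Bool) → Set
    Closed R = ∀ {e} → e ∈ S → Joined (bit ∘ R) e

    step-sound : ∀ {R g} {v} → All (Joined g) S → (∀ v → T (R v) → g v ≡ g 1) → T (reachStep S R v) → g v ≡ g 1
    step-sound {R} {g} {v} joins sound t with to (T-∨ {R v}) t
    ... | inj₁ r = sound v r
    ... | inj₂ r with (a , b) , ab∈ , s ← find (any⁻ _ S r) with to (T-∨ {R a ∧ (b ≡ᵇ v)}) s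
    ...   | inj₁ q with q₁ , q₂ ← to (T-∧ {R a}) q with refl ← ≡ᵇ⇒≡ b v q₂ = trans (sym (All.lookup joins ab∈)) (sound a q₁)
    ...   | inj₂ q with q₁ , q₂ ← to (T-∧ {R b}) q with refl ← ≡ᵇ⇒≡ a v q₂ = trans (All.lookup joins ab∈) (sound b q₁)

    -- A labelling constant along the edges cannot distinguish reached vertices; for `contract id S`
    -- this says that the search stays in the component of 1.
    iterate-sound : ∀ m {R g} → All (Joined g) S → (∀ v → T (R v) → g v ≡ g 1) → ∀ v → T (iterate m R S v) → g v ≡ g 1
    iterate-sound zero joins sound = sound
    iterate-sound (suc m) joins sound = iterate-sound m joins (λ v → step-sound joins sound)

    iterate-⊇ : ∀ m {R v} → T (R v) → T (iterate m R S v)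
    iterate-⊇ zero t = t
    iterate-⊇ (suc m) {R} t = iterate-⊇ m (step-⊇ R t)

    step-closed : ∀ {R} → Closed R → ∀ v → bit (reachStep S R v) ≡ bit (R v)
    step-closed {R} closed v = bit-≡ back (step-⊇ R)
      where
      back : T (reachStep S R v) → T (R v)
      back t with to (T-∨ {R v}) t
      ... | inj₁ r = r
      ... | inj₂ r with (a , b) , ab∈ , s ← find (any⁻ _ S r) with to (T-∨ {R a ∧ (b ≡ᵇ v)}) s
      ...   | inj₁ q with q₁ , q₂ ← to (T-∧ {R a}) q with refl ← ≡ᵇ⇒≡ b v q₂ = bit-T (closed ab∈) q₁
      ...   | inj₂ q with q₁ , q₂ ← to (T-∧ {R b}) q with refl ← ≡ᵇ⇒≡ a v q₂ = bit-T (sym (closed ab∈)) q₁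

    iterate-closed : ∀ m {R} → Closed R → Closed (iterate m R S)
    iterate-closed zero closed = closed
    iterate-closed (suc m) {R} closed = iterate-closed m
      (λ {e} e∈ → trans (step-closed {R} closed (proj₁ e)) (trans (closed e∈) (sym (step-closed {R} closed (proj₂ e)))))

  card : (ℕ → Bool) → ℕ
  card R = ∑ V (bit ∘ R)

  card-strict : ∀ W {R R′ : ℕ → Bool} → (∀ {v} → T (R v) → T (R′ v)) →
    (∀ {v} → v ∈ W → T (R′ v) → T (R v)) ⊎ ∑ W (bit ∘ R) < ∑ W (bit ∘ R′)
  card-strict [] mono = inj₁ λ ()
  card-strict (w ∷ W) {R} {R′} mono with R w in p | R′ w in q | card-strict W {R} {R′} mono
  ... | true | true | inj₁ eq = inj₁ λ { (here refl) _ → subst T (sym p) tt ; (there v∈) → eq v∈ }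
  ... | true | true | inj₂ lt = inj₂ (s≤s lt)
  ... | true | false | _ = ⊥-elim (subst T q (mono (subst T (sym p) tt)))
  ... | false | true | inj₁ eq = inj₂ (s≤s (card-mono W))
    where
    card-mono : ∀ U → ∑ U (bit ∘ R) ≤ ∑ U (bit ∘ R′)
    card-mono [] = z≤n
    card-mono (u ∷ U) = +-mono-≤ (bit-mono mono) (card-mono U)
      where
      bit-mono : ∀ {x y} → (T x → T y) → bit x ≤ bit y
      bit-mono {true} {true} _ = ≤-refl
      bit-mono {true} {false} g = ⊥-elim (g tt)
      bit-mono {false} _ = z≤n
  ... | false | true | inj₂ lt = inj₂ (≤-trans lt (n≤1+n _))
  ... | false | false | inj₁ eq = inj₁ λ { (here refl) t → ⊥-elim (subst T q t) ; (there v∈) → eq v∈ }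
  ... | false | false | inj₂ lt = inj₂ lt

  -- A step that is not yet stable on `V` reaches a new vertex there, and closedness, once attained,
  -- persists.
  iterate-grows : ∀ {S} → All Inside S → ∀ m R → Closed S (iterate m R S) ⊎ m + card R ≤ card (iterate m R S)
  iterate-grows inside zero R = inj₂ ≤-refl
  iterate-grows {S} inside (suc m) R with card-strict V {R} {reachStep S R} (step-⊇ S R)
  ... | inj₁ stable = inj₁ (iterate-closed S (suc m) {R} closed)
    where
    closed : Closed S R
    closed ab∈ with a∈ , b∈ ← All.lookup inside ab∈ =
      bit-≡ (λ t → stable b∈ (step-→ S R ab∈ t)) (λ t → stable a∈ (step-← S R ab∈ t))
  ... | inj₂ lt with iterate-grows inside m (reachStep S R)
  ...   | inj₁ closed = inj₁ closed
  ...   | inj₂ le = inj₂ (≤-trans (≤-trans (≤-reflexive (sym (+-suc m _))) (+-monoʳ-≤ m lt)) le)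

  -- The start set is not empty, so `length V` strict gains would give more vertices than `V` has.
  iterate-saturates : ∀ {S R u} → All Inside S → u ∈ V → T (R u) → Closed S (iterate (length V) R S)
  iterate-saturates {S} {R} inside u∈ t with iterate-grows inside (length V) R
  ... | inj₁ closed = closed
  ... | inj₂ le = contradiction (≤-trans (≤-trans (≤-reflexive (+-comm 1 _)) (+-monoʳ-≤ (length V) (1≤card V u∈ t)))
      (≤-trans le (card≤ V))) 1+n≰n
    where
    1≤card : ∀ W {w} → w ∈ W → T (R w) → 1 ≤ ∑ W (bit ∘ R)
    1≤card (w ∷ W) (here refl) t with R w
    ... | true = s≤s z≤n
    1≤card (w ∷ W) (there w∈) t = ≤-trans (1≤card W w∈ t) (m≤n+m _ (bit (R w)))
    card≤ : ∀ W → ∑ W (bit ∘ iterate (length V) R S) ≤ length W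
    card≤ [] = z≤n
    card≤ (w ∷ W) with iterate (length V) R S w
    ... | true = s≤s (card≤ W)
    ... | false = ≤-trans (card≤ W) (n≤1+n _)

-- Uprooted trees as spanning trees of a smaller graph

vertices-bounds : ∀ {n v} → v ∈ vertices n → 1 ≤ v × v ≤ n
vertices-bounds v∈ with _ , i<n , refl ← ∈-applyUpTo⁻ suc v∈ = s≤s z≤n , i<n

∈-vertices : ∀ {n v} → 1 ≤ v → v ≤ n → v ∈ vertices n
∈-vertices {v = suc v} _ v≤n = ∈-applyUpTo⁺ suc v≤n

unique-vertices : ∀ n → Unique (vertices n)
unique-vertices n = Unique.applyUpTo⁺₁ suc n (λ i<j _ eq → <⇒≢ i<j (suc-injective eq))

length-vertices : ∀ n → length (vertices n) ≡ n
length-vertices n = length-applyUpTo suc n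

isSpanningTree⇔ : ∀ n → 1 ≤ n → ∀ S → All (Inside (vertices n)) S →
  T (isSpanningTree n S) ⇔ (Connects (vertices n) id S × length S ≡ n ∸ 1)
isSpanningTree⇔ n 1≤n S inside = mk⇔ sound complete′
  where
  V = vertices n
  1∈ : 1 ∈ V
  1∈ = ∈-vertices ≤-refl 1≤n
  source : ℕ → Bool
  source v = v ≡ᵇ 1

  sound : T (isSpanningTree n S) → Connects V id S × length S ≡ n ∸ 1
  sound t with reached , |S| ← to T-∧ t = (λ _ _ u∈ v∈ → trans (label u∈) (sym (label v∈))) , ≡ᵇ⇒≡ _ _ |S|
    where
    label : ∀ {v} → v ∈ V → contract id S v ≡ contract id S 1
    label {v} v∈ = iterate-sound V S n {source} (contract-joins id S) (λ u t → cong (contract id S) (≡ᵇ⇒≡ u 1 t)) v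
      (All.lookup (all⁺ _ V reached) v∈)

  complete′ : Connects V id S × length S ≡ n ∸ 1 → T (isSpanningTree n S)
  complete′ (conn , |S|) = from T-∧ (all⁻ _ (All.tabulate reached) , ≡⇒≡ᵇ _ _ |S|)
    where
    closed : Closed V S (iterate n source S)
    closed = subst (λ m → Closed V S (iterate m source S)) (length-vertices n) (iterate-saturates V inside 1∈ tt)
    reached : ∀ {v} → v ∈ V → T (reachableFrom1 n S v)
    reached v∈ = bit-T (contract-least S (λ u v → cong (bit ∘ iterate n source S)) (All.tabulate closed) _ _
        (conn _ _ 1∈ v∈))
      (iterate-⊇ V S n {source} {1} tt)

blocks-id : ∀ n → Blocks (vertices n) id (vertices n)
blocks-id n .unique = unique-vertices n
blocks-id n .cover = id

count-spanning-trees : ∀ n E → 1 ≤ n → All (Inside (vertices n)) E → count (isSpanningTree n) E ≡ τ id (n ∸ 1) E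
count-spanning-trees n E 1≤n inside = count-trees (vertices n) id (n ∸ 1) E (isSpanningTree n) (blocks-id n)
    (λ {l} l∈ → l , l∈ , refl)
  (trans (length-vertices n) (sym (m+[n∸m]≡n 1≤n))) inside (isSpanningTree⇔ n 1≤n)

-- A condition imposed on each edge separately amounts to deleting edges; this turns the root
-- condition into a change of graph.
count-all : {A : Set} (p : List A → Bool) (q : A → Bool) (E : List A) →
    count (λ S → p S ∧ all q S) E ≡ count p (filterᵇ q E)
count-all p q [] with p []
... | true = refl
... | false = refl
count-all p q (e ∷ E) with q e in eq
... | true = begin
  count (λ S → p S ∧ all q S) (e ∷ E)   ≡⟨ count-∷ (λ S → p S ∧ all q S) e E ⟩
  count (λ S → p S ∧ all q S) E + count (λ S → p (e ∷ S) ∧ all q (e ∷ S)) E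
    ≡⟨ cong₂ _+_ (count-all p q E)
        (trans (count-cong _ _ E (λ S → cong (λ x → p (e ∷ S) ∧ (x ∧ all q S)) eq)) (count-all (p ∘ (e ∷_)) q E)) ⟩
  count p (filterᵇ q E) + count (p ∘ (e ∷_)) (filterᵇ q E) ≡⟨ count-∷ p e (filterᵇ q E) ⟨
  count p (e ∷ filterᵇ q E) ∎
  where open ≡-Reasoning
... | false = begin
  count (λ S → p S ∧ all q S) (e ∷ E)   ≡⟨ count-∷ (λ S → p S ∧ all q S) e E ⟩
  count (λ S → p S ∧ all q S) E + count (λ S → p (e ∷ S) ∧ all q (e ∷ S)) E
    ≡⟨ cong₂ _+_ (count-all p q E) (count-none {P = λ _ → ⊤} _ (All.universal _ E)
      (λ S _ t → subst T eq (proj₁ (to T-∧ (proj₂ (to (T-∧ {p (e ∷ S)}) t)))))) ⟩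
  count p (filterᵇ q E) + 0 ≡⟨ +-identityʳ _ ⟩
  count p (filterᵇ q E) ∎
  where open ≡-Reasoning

T-not⁻ : ∀ {x} → T (not x) → ¬ T x
T-not⁻ {false} _ ()

T-not⁺ : ∀ {x} → ¬ T x → T (not x)
T-not⁺ {false} _ = _
T-not⁺ {true} ¬t = ⊥-elim (¬t _)

below : ℕ → Edge → Bool
below r (a , b) = (not (a ≡ᵇ r) ∨ (b <ᵇ r)) ∧ (not (b ≡ᵇ r) ∨ (a <ᵇ r))

edges : ℕ → ℕ → List Edge
edges n r = filterᵇ (below r) (edgesKnMinus1n n)

module _ (n r : ℕ) where

  -- Since a < b, the root test fails only for a = r: the deleted edges are those from `r` upwards.
  edges⁻ : ∀ {a b} → (a , b) ∈ edges n r →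
    (a ∈ vertices n × b ∈ vertices n) × a < b × ¬ (a ≡ 1 × b ≡ n) × a ≢ r
  edges⁻ {a} {b} e∈ with e∈′ , t ← ∈-filter⁻ _ {xs = edgesKnMinus1n n} e∈
    with e∈″ , u ← ∈-filter⁻ _ {xs = pairs (vertices n)} e∈′
    with u₁ , u₂ ← to (T-∧ {a <ᵇ b}) u | t₁ , _ ← to (T-∧ {not (a ≡ᵇ r) ∨ (b <ᵇ r)}) t =
    ∈-pairs⁻ (vertices n) e∈″ , a<b ,
    (λ { (p , q) → T-not⁻ u₂ (from T-∧ (≡⇒≡ᵇ a 1 p , ≡⇒≡ᵇ b n q)) }) , a≢r
    where
    a<b = <ᵇ⇒< a b u₁
    a≢r : a ≢ r
    a≢r refl = [ (λ s → T-not⁻ s (≡⇒≡ᵇ a a refl)) , (λ s → <-asym a<b (<ᵇ⇒< b a s)) ]′ (to (T-∨ {not (a ≡ᵇ r)}) t₁)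

  edges⁺ : ∀ {a b} → a ∈ vertices n → b ∈ vertices n → a < b → ¬ (a ≡ 1 × b ≡ n) → a ≢ r → (a , b) ∈ edges n r
  edges⁺ {a} {b} a∈ b∈ a<b ¬1n a≢r = ∈-filter⁺ _ (∈-filter⁺ _ (∈-pairs⁺ (vertices n) a∈ b∈)
      (from T-∧ (<⇒<ᵇ a<b , T-not⁺ (λ t → let p , q = to (T-∧ {a ≡ᵇ 1}) t in ¬1n (≡ᵇ⇒≡ a 1 p , ≡ᵇ⇒≡ b n q)))))
    (from T-∧ (from T-∨ (inj₁ (T-not⁺ (a≢r ∘ ≡ᵇ⇒≡ a r))) , from T-∨ second))
    where
    second : T (not (b ≡ᵇ r)) ⊎ T (a <ᵇ r)
    second with b ≟ r
    ... | yes refl = inj₂ (<⇒<ᵇ a<b)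
    ... | no b≢r = inj₁ (T-not⁺ (b≢r ∘ ≡ᵇ⇒≡ b r))

  edges-unique : Unique (edges n r)
  edges-unique = Unique.filter⁺ _ (Unique.filter⁺ _ (pairs-unique (vertices n) (unique-vertices n)))

numUprooted≡τ : ∀ n r → 1 ≤ n → numUprooted n r ≡ τ id (n ∸ 1) (edges n r)
numUprooted≡τ n r 1≤n = begin
  numUprooted n r
    ≡⟨ count-cong (isUprootedSpanningTree n r) (λ S → isSpanningTree n S ∧ all (below r) S) (edgesKnMinus1n n)
                       -- The edge test inside `rootAboveNeighbours` and `below r` are different
                       -- functions that agree at each edge.
                       (λ S → cong (λ bs → isSpanningTree n S ∧ and bs) (map-cong (λ _ → refl) S)) ⟩
  count (λ S → isSpanningTree n S ∧ all (below r) S) (edgesKnMinus1n n)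
    ≡⟨ count-all (isSpanningTree n) (below r) (edgesKnMinus1n n) ⟩
  count (isSpanningTree n) (edges n r) ≡⟨ count-spanning-trees n (edges n r) 1≤n (All.tabulate (proj₁ ∘ edges⁻ n r)) ⟩
  τ id (n ∸ 1) (edges n r) ∎
  where open ≡-Reasoning

-- Comparison with the complete graph

-- For lists without repetitions equal membership already gives a permutation, so the order in which
-- edges are enumerated never has to be traced.
partition-↭ : {A : Set} {D E C : List A} → Unique D → Unique E → Unique C →
  (∀ {e} → e ∈ D → e ∉ E) → (∀ {e} → e ∈ D → e ∈ C) → (∀ {e} → e ∈ E → e ∈ C) →
  (∀ {e} → e ∈ C → e ∈ D ⊎ e ∈ E) → D ++ E ↭ C
partition-↭ {D = D} uD uE uC disj D⊆ E⊆ C⊆ = ∼bag⇒↭ (unique∧set⇒bag (Unique.++⁺ uD uE (λ (d , e) → disj d e)) uC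
  (mk⇔ ([ D⊆ , E⊆ ]′ ∘ ∈-++⁻ D) ([ ∈-++⁺ˡ , ∈-++⁺ʳ D ]′ ∘ C⊆)))

∏-ones : ∀ xs {g : ℕ → ℕ} → (∀ {x} → x ∈ xs → g x ≡ 1) → ∏ xs g ≡ 1
∏-ones [] ones = refl
∏-ones (x ∷ xs) ones = cong₂ _*_ (ones (here refl)) (∏-ones xs (ones ∘ there))

δ-sym : ∀ k l → δ k l ≡ δ l k
δ-sym k l with k ≟ l
... | yes refl = sym (δ-refl k)
... | no k≢l = sym (δ-≢ (k≢l ∘ sym))

size-id : ∀ n {v} → v ∈ vertices n → size (vertices n) id v ≡ 1
size-id n {v} v∈ = trans (∑-cong (vertices n) (λ w → trans (δ-sym v w) (sym (*-identityʳ _))))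
    (∑-δ (λ _ → 1) (unique-vertices n) v∈)

-- Keeps the remaining labels in place, so that the list retains the form centre, leaves, others
-- required by `deleted-star`.
blocks-merge : ∀ V f a b xs {ys} → f a ≢ f b → a ∈ V → Blocks V f (xs ++ f b ∷ ys) → Blocks V (f ⊕ (a , b)) (xs ++ ys)
blocks-merge V f a b xs {ys} ¬ab a∈ B with B′ ← blocks-↭ V (↭.shift (f b) xs ys) B with fb∉ ∷ _ ← unique B′ =
  subst (Blocks V (f ⊕ (a , b))) (trans (remove-≡ (f b) (xs ++ ys)) (remove-∉ fb∉)) (blocks-⊕ V f a b ¬ab a∈ B′)

module Complete (n : ℕ) where
  V = vertices n

  complete⁻ : ∀ {a b} → (a , b) ∈ complete V → (a ∈ V × b ∈ V) × a < b
  complete⁻ {a} {b} e∈ with e∈′ , t ← ∈-filter⁻ _ {xs = pairs V} e∈ = ∈-pairs⁻ V e∈′ , <ᵇ⇒< a b t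

  complete⁺ : ∀ {a b} → a ∈ V → b ∈ V → a < b → (a , b) ∈ complete V
  complete⁺ a∈ b∈ a<b = ∈-filter⁺ _ (∈-pairs⁺ V a∈ b∈) (<⇒<ᵇ a<b)

  complete-unique : Unique (complete V)
  complete-unique = Unique.filter⁺ _ (pairs-unique (vertices n) (unique-vertices n))

-- Every neighbour of n is smaller, so only {1, n} is missing. Of the n^(n-2) trees of K_n, 2n^(n-3)
-- contain it, the 2 being the size of the block {1, n}.
numUprooted-top : ∀ t → let n = 3 + t in numUprooted n n ≡ n ^ t * suc t
numUprooted-top t = *-cancelˡ-≡ _ _ n (+-cancelʳ-≡ (n ^ suc t * 2) _ _ (begin
  n * numUprooted n n + n ^ suc t * 2     ≡⟨ cong₂ (λ x y → n * x + y) (numUprooted≡τ n n (s≤s z≤n)) (sym T₁) ⟩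
  n * τ id (2 + t) E + n * τ f₁ (suc t) F
    ≡⟨ cong (λ x → n * τ id (2 + t) E + n * x) (τ-joined f₁ (suc t) e₁ E (⊕-joins id e₁)) ⟩
  n * τ id (2 + t) E + n * τ f₁ (suc t) E ≡⟨ *-distribˡ-+ n (τ id (2 + t) E) _ ⟨
  n * (τ id (2 + t) E + τ f₁ (suc t) E)   ≡⟨ cong (n *_) (τ-unjoined id (suc t) e₁ E (λ ())) ⟨
  n * τ id (2 + t) F                      ≡⟨ T₀ ⟩
  n ^ (2 + t)                             ≡⟨ ring t (n ^ t) ⟩
  n * (n ^ t * suc t) + n ^ suc t * 2     ∎))
  where
  open ≡-Reasoning
  n = 3 + t
  open Complete n
  E = edges n n
  e₁ : Edge
  e₁ = 1 , n
  F : List Edge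
  F = e₁ ∷ E
  f₁ = id ⊕ e₁
  M = applyUpTo (λ i → 2 + i) (suc t)

  ring : ∀ t P → (3 + t) * ((3 + t) * P) ≡ (3 + t) * (P * suc t) + (3 + t) * P * 2
  ring = solve-∀

  1∈ : 1 ∈ V
  1∈ = ∈-vertices ≤-refl (s≤s z≤n)
  n∈ : n ∈ V
  n∈ = ∈-vertices (s≤s z≤n) ≤-refl

  perm : F ↭ complete V
  perm = partition-↭ ([] ∷ []) (edges-unique n n) complete-unique
    (λ { (here refl) e∈ → proj₁ (proj₂ (proj₂ (edges⁻ n n e∈))) (refl , refl) })
    (λ { (here refl) → complete⁺ 1∈ n∈ (s≤s (s≤s z≤n)) })
    (λ e∈ → let (a∈ , b∈) , a<b , _ = edges⁻ n n e∈ in complete⁺ a∈ b∈ a<b) split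
    where
    split : ∀ {e} → e ∈ complete V → e ∈ e₁ ∷ [] ⊎ e ∈ E
    split {a , b} e∈ with (a∈ , b∈) , a<b ← complete⁻ e∈ with a ≟ 1 | b ≟ n
    ... | yes refl | yes refl = inj₁ (here refl)
    ... | no a≢1 | _ = inj₂ (edges⁺ n n a∈ b∈ a<b (a≢1 ∘ proj₁) (<⇒≢ (<-≤-trans a<b (proj₂ (vertices-bounds b∈)))))
    ... | _ | no b≢n = inj₂ (edges⁺ n n a∈ b∈ a<b (b≢n ∘ proj₂) (<⇒≢ (<-≤-trans a<b (proj₂ (vertices-bounds b∈)))))

  T₀ : n * τ id (2 + t) F ≡ n ^ (2 + t)
  T₀ = begin
    n * τ id (2 + t) F               ≡⟨ cong (n *_) (τ-↭ id (2 + t) perm) ⟩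
    n * τ id (2 + t) (complete V)    ≡⟨ cong (_* τ id (2 + t) (complete V)) (length-vertices n) ⟨
    length V * τ id (2 + t) (complete V) ≡⟨ cayley V id (2 + t) (blocks-id n) (length-vertices n) ⟩
    length V ^ (2 + t) * ∏ V (size V id)
      ≡⟨ cong₂ (λ l w → l ^ (2 + t) * w) (length-vertices n) (∏-ones V (size-id n)) ⟩
    n ^ (2 + t) * 1                  ≡⟨ *-identityʳ _ ⟩
    n ^ (2 + t)                      ∎

  T₁ : n * τ f₁ (suc t) F ≡ n ^ suc t * 2
  T₁ = begin
    n * τ f₁ (suc t) F               ≡⟨ cong (n *_) (τ-↭ f₁ (suc t) perm) ⟩
    n * τ f₁ (suc t) (complete V)    ≡⟨ cong (_* τ f₁ (suc t) (complete V)) (length-vertices n) ⟨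
    length V * τ f₁ (suc t) (complete V)
      ≡⟨ cayley V f₁ (suc t) (blocks-⊕ V id 1 n (λ ()) 1∈ (blocks-id n))
          (suc-injective (trans (length-remove (unique-vertices n) n∈) (length-vertices n))) ⟩
    length V ^ suc t * ∏ (remove n V) (size V f₁) ≡⟨ cong₂ (λ l w → l ^ suc t * w) (length-vertices n) W ⟩
    n ^ suc t * 2                    ∎
    where
    except-one : ∀ l k g → g k ≡ 1 → except l g k ≡ 1
    except-one l k g g≡1 with k ≟ l
    ... | yes _ = refl
    ... | no _ = g≡1
    W : ∏ (remove n V) (size V f₁) ≡ 2
    W = trans (∏-size-⊕ V id 1 n (λ ()) 1∈ (blocks-id n)) (cong₂ _*_ (cong₂ _+_ (size-id n 1∈) (size-id n n∈))
      (∏-ones V (λ {v} v∈ → except-one 1 v (except n (size V id)) (except-one n v (size V id) (size-id n v∈)))))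

-- Roots below n

module _ (j s : ℕ) where
  private
    -- Here k = n - r = j + 1. The vertices above `r` are the `j` elements of `L` and n itself; the
    -- `s` elements of `M` lie strictly between 1 and `r`.
    m = 2 + (j + s)
    n = suc m
    r = 2 + s
    open Complete n
    E = edges n r
    e₁ e₂ : Edge
    e₁ = 1 , n
    e₂ = r , n
    F : List Edge
    F = e₁ ∷ e₂ ∷ E
    f₁ = id ⊕ e₁
    f₂ = id ⊕ e₂
    f₃ = f₁ ⊕ e₂
    L = applyUpTo (λ i → suc (r + i)) j
    M = applyUpTo (λ i → 2 + i) s

    r<n : r < n
    r<n = s≤s (s≤s (s≤s (m≤n+m s j)))
    1∈ : 1 ∈ V
    1∈ = ∈-vertices ≤-refl (s≤s z≤n)
    n∈ : n ∈ V
    n∈ = ∈-vertices (s≤s z≤n) ≤-refl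
    r∈ : r ∈ V
    r∈ = ∈-vertices (s≤s z≤n) (<⇒≤ r<n)
    r≢n : r ≢ n
    r≢n = <⇒≢ r<n

    L⁻ : ∀ {l} → l ∈ L → r < l × l < n
    L⁻ l∈ with i , i<j , refl ← ∈-applyUpTo⁻ _ l∈ = s≤s (m≤m+n r i) ,
      s≤s (s≤s (s≤s (≤-trans (≤-reflexive (sym (+-suc s i))) (≤-trans (+-monoʳ-≤ s i<j) (≤-reflexive (+-comm s j))))))

    L⁺ : ∀ {l} → r < l → l < n → l ∈ L
    L⁺ {l} r<l l<n with i , refl ← m≤n⇒∃[o]m+o≡n r<l = ∈-applyUpTo⁺ _
      (+-cancelˡ-< s i j (s≤s⁻¹ (s≤s⁻¹ (s≤s⁻¹ (≤-trans l<n (≤-reflexive (cong (_+_ 3) (+-comm j s))))))))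

    M⁻ : ∀ {v} → v ∈ M → 1 < v × v < r
    M⁻ v∈ with i , i<s , refl ← ∈-applyUpTo⁻ _ v∈ = s≤s (s≤s z≤n) , s≤s (s≤s i<s)

    M⁺ : ∀ {v} → 1 < v → v < r → v ∈ M
    M⁺ {suc (suc i)} _ (s≤s (s≤s i<s)) = ∈-applyUpTo⁺ _ i<s
    M⁺ {suc zero} (s≤s ()) _

    L⊆ : ∀ {l} → l ∈ L → l ∈ V
    L⊆ l∈ with r<l , l<n ← L⁻ l∈ = ∈-vertices (≤-trans (s≤s z≤n) r<l) (<⇒≤ l<n)
    M⊆ : ∀ {v} → v ∈ M → v ∈ V
    M⊆ v∈ with 1<v , v<r ← M⁻ v∈ = ∈-vertices (<⇒≤ 1<v) (<⇒≤ (<-trans v<r r<n))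

    perm : map (r ,_) L ++ F ↭ complete V
    perm = ↭-trans (↭-trans (↭.shift e₁ (map (r ,_) L) (e₂ ∷ E)) (prep e₁ (↭.shift e₂ (map (r ,_) L) E)))
      (partition-↭ D-unique (edges-unique n r) complete-unique D∉E D⊆
        (λ e∈ → let (a∈ , b∈) , a<b , _ = edges⁻ n r e∈ in complete⁺ a∈ b∈ a<b) split)
      where
      D = e₁ ∷ e₂ ∷ map (r ,_) L
      D-unique : Unique D
      D-unique = ((λ ()) ∷ All.tabulate e₁∉) ∷ All.tabulate e₂∉ ∷
          Unique.map⁺ (cong proj₂) (Unique.applyUpTo⁺₁ _ j (λ i<k _ eq → <⇒≢ i<k (+-cancelˡ-≡ (suc r) _ _ eq)))
        where
        e₁∉ : ∀ {e} → e ∈ map (r ,_) L → e₁ ≢ e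
        e₁∉ e∈ eq with _ , _ , refl ← ∈-map⁻ _ e∈ with () ← cong proj₁ eq
        e₂∉ : ∀ {e} → e ∈ map (r ,_) L → e₂ ≢ e
        e₂∉ e∈ eq with _ , l∈ , refl ← ∈-map⁻ _ e∈ = <⇒≢ (proj₂ (L⁻ l∈)) (sym (cong proj₂ eq))
      D∉E : ∀ {e} → e ∈ D → e ∉ E
      D∉E (here refl) e∈ = proj₁ (proj₂ (proj₂ (edges⁻ n r e∈))) (refl , refl)
      D∉E (there (here refl)) e∈ = proj₂ (proj₂ (proj₂ (edges⁻ n r e∈))) refl
      D∉E (there (there d∈)) e∈ with _ , _ , refl ← ∈-map⁻ _ d∈ = proj₂ (proj₂ (proj₂ (edges⁻ n r e∈))) refl
      D⊆ : ∀ {e} → e ∈ D → e ∈ complete V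
      D⊆ (here refl) = complete⁺ 1∈ n∈ (s≤s (s≤s z≤n))
      D⊆ (there (here refl)) = complete⁺ r∈ n∈ r<n
      D⊆ (there (there d∈)) with _ , l∈ , refl ← ∈-map⁻ _ d∈ = complete⁺ r∈ (L⊆ l∈) (proj₁ (L⁻ l∈))
      split : ∀ {e} → e ∈ complete V → e ∈ D ⊎ e ∈ E
      split {a , b} e∈ with (a∈ , b∈) , a<b ← complete⁻ e∈ with a ≟ r | b ≟ n | a ≟ 1
      ... | yes refl | yes refl | _ = inj₁ (there (here refl))
      ... | yes refl | no b≢n | _ = inj₁ (there (there (∈-map⁺ _ (L⁺ a<b (≤∧≢⇒< (proj₂ (vertices-bounds b∈)) b≢n)))))
      ... | no a≢r | yes refl | yes refl = inj₁ (here refl)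
      ... | no a≢r | yes refl | no a≢1 = inj₂ (edges⁺ n r a∈ b∈ a<b (a≢1 ∘ proj₁) a≢r)
      ... | no a≢r | no b≢n | _ = inj₂ (edges⁺ n r a∈ b∈ a<b (b≢n ∘ proj₂) a≢r)

    -- n is listed among the others and not among the leaves, so it can be merged with 1 or with `r`
    -- while all leaves stay singletons.
    blocks₀ : Blocks V id (r ∷ L ++ n ∷ 1 ∷ M)
    blocks₀ .unique = All.tabulate r≢ ∷ Unique.++⁺
      (Unique.applyUpTo⁺₁ _ j (λ i<k _ eq → <⇒≢ i<k (+-cancelˡ-≡ (suc r) _ _ eq)))
      (All.tabulate n≢ ∷ All.tabulate (λ v∈ → <⇒≢ (proj₁ (M⁻ v∈))) ∷
          Unique.applyUpTo⁺₁ _ s (λ i<k _ eq → <⇒≢ i<k (+-cancelˡ-≡ 2 _ _ eq)))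
      (λ (l∈ , v∈) → L-disjoint l∈ v∈)
      where
      n≢ : ∀ {v} → v ∈ 1 ∷ M → n ≢ v
      n≢ (here refl) ()
      n≢ (there v∈) = <⇒≢ (<-trans (proj₂ (M⁻ v∈)) r<n) ∘ sym
      L-disjoint : ∀ {l} → l ∈ L → l ∉ n ∷ 1 ∷ M
      L-disjoint l∈ (here refl) = <-irrefl refl (proj₂ (L⁻ l∈))
      L-disjoint l∈ (there (here refl)) = contradiction (proj₁ (L⁻ l∈)) λ { (s≤s ()) }
      L-disjoint l∈ (there (there v∈)) = <-asym (proj₁ (L⁻ l∈)) (proj₂ (M⁻ v∈))
      r≢ : ∀ {v} → v ∈ L ++ n ∷ 1 ∷ M → r ≢ v
      r≢ v∈ with ∈-++⁻ L v∈
      ... | inj₁ l∈ = <⇒≢ (proj₁ (L⁻ l∈))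
      ... | inj₂ (here refl) = r≢n
      ... | inj₂ (there (here refl)) = λ ()
      ... | inj₂ (there (there v∈M)) = <⇒≢ (proj₂ (M⁻ v∈M)) ∘ sym
    blocks₀ .cover {v} v∈ with v ≟ 1 | v ≟ r | v ≟ n | v <? r
    ... | yes refl | _ | _ | _ = there (∈-++⁺ʳ L (there (here refl)))
    ... | _ | yes refl | _ | _ = here refl
    ... | _ | _ | yes refl | _ = there (∈-++⁺ʳ L (here refl))
    ... | no v≢1 | _ | _ | yes v<r = there (∈-++⁺ʳ L (there (there
        (M⁺ (≤∧≢⇒< (proj₁ (vertices-bounds v∈)) (v≢1 ∘ sym)) v<r))))
    ... | _ | no v≢r | no v≢n | no v≮r = there (∈-++⁺ˡ (L⁺ (≤∧≢⇒< (≮⇒≥ v≮r) (v≢r ∘ sym))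
        (≤∧≢⇒< (proj₂ (vertices-bounds v∈)) v≢n)))

    blocks₁ : Blocks V f₁ (r ∷ L ++ 1 ∷ M)
    blocks₁ = blocks-merge V id 1 n (r ∷ L) (λ ()) 1∈ blocks₀

    blocks₂ : Blocks V f₂ (r ∷ L ++ 1 ∷ M)
    blocks₂ = blocks-merge V id r n (r ∷ L) r≢n r∈ blocks₀

    f₁n : f₁ n ≡ 1
    f₁n = relabel-target 1 n
    f₁r : f₁ r ≡ r
    f₁r = relabel-other 1 r≢n

    ¬joined₃ : f₁ r ≢ f₁ n
    ¬joined₃ eq with () ← trans (sym f₁r) (trans eq f₁n)

    -- After {1, n} is contracted n carries the label 1, so contracting {r, n} absorbs the label 1
    -- and gives `r` a block of size 3.
    blocks₃ : Blocks V f₃ (r ∷ L ++ M)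
    blocks₃ = blocks-merge V f₁ r n (r ∷ L) ¬joined₃ r∈ (subst (λ l → Blocks V f₁ (r ∷ L ++ l ∷ M)) (sym f₁n) blocks₁)

    size₁-other : ∀ {v} → v ∈ V → v ≢ 1 → v ≢ n → size V f₁ v ≡ 1
    size₁-other v∈ v≢1 v≢n = trans (size-⊕-other V id 1 n (λ ()) v≢1 v≢n) (size-id n v∈)
    size₁-1 : size V f₁ 1 ≡ 2
    size₁-1 = trans (size-⊕-source V id 1 n (λ ())) (cong₂ _+_ (size-id n 1∈) (size-id n n∈))
    size₂-other : ∀ {v} → v ∈ V → v ≢ r → v ≢ n → size V f₂ v ≡ 1
    size₂-other v∈ v≢r v≢n = trans (size-⊕-other V id r n r≢n v≢r v≢n) (size-id n v∈)
    size₂-r : size V f₂ r ≡ 2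
    size₂-r = trans (size-⊕-source V id r n r≢n) (cong₂ _+_ (size-id n r∈) (size-id n n∈))
    size₃-other : ∀ {v} → v ∈ V → v ≢ 1 → v ≢ r → v ≢ n → size V f₃ v ≡ 1
    size₃-other v∈ v≢1 v≢r v≢n = trans
      (size-⊕-other V f₁ r n ¬joined₃ (λ eq → v≢r (trans eq f₁r)) (λ eq → v≢1 (trans eq f₁n)))
      (size₁-other v∈ v≢1 v≢n)
    size₃-r : size V f₃ r ≡ 3
    size₃-r = trans (cong (size V f₃) (sym f₁r)) (trans (size-⊕-source V f₁ r n ¬joined₃)
      (cong₂ _+_ (trans (cong (size V f₁) f₁r) (size₁-other r∈ (λ ()) r≢n)) (trans (cong (size V f₁) f₁n) size₁-1)))

    L≢1 : ∀ {l} → l ∈ L → l ≢ 1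
    L≢1 l∈ refl = contradiction (proj₁ (L⁻ l∈)) λ { (s≤s ()) }
    L≢r : ∀ {l} → l ∈ L → l ≢ r
    L≢r l∈ = <⇒≢ (proj₁ (L⁻ l∈)) ∘ sym
    L≢n : ∀ {l} → l ∈ L → l ≢ n
    L≢n l∈ = <⇒≢ (proj₂ (L⁻ l∈))
    M≢1 : ∀ {v} → v ∈ M → v ≢ 1
    M≢1 v∈ = <⇒≢ (proj₁ (M⁻ v∈)) ∘ sym
    M≢r : ∀ {v} → v ∈ M → v ≢ r
    M≢r v∈ = <⇒≢ (proj₂ (M⁻ v∈))
    M≢n : ∀ {v} → v ∈ M → v ≢ n
    M≢n v∈ = <⇒≢ (<-trans (proj₂ (M⁻ v∈)) r<n)

    -- The index is written `R + j` because for `R = 2 + s` it computes to `2 + c`, the form in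
    -- which inclusion-exclusion uses it.
    evaluate : ∀ f others {R x p} → Blocks V f (r ∷ L ++ others) → f r ≡ r →
        (∀ {l} → l ∈ L → f l ≡ l × size V f l ≡ 1) →
      length others ≡ R → size V f r ≡ x → ∏ others (size V f) ≡ p →
      n * m * τ f (R + j) F + n ^ R * m ^ j * (j * p) ≡ n ^ R * m ^ j * (m * x * p)
    evaluate f others {R} B fr leaf refl refl refl = subst
      (λ c → n * m * τ f c F + n ^ R * m ^ j * (j * ∏ others (size V f))
          ≡ n ^ R * m ^ j * (m * size V f r * ∏ others (size V f)))
      (+-comm j R)
      (subst (λ i → n * m * τ f (i + R) F + n ^ R * m ^ i * (i * ∏ others (size V f))
          ≡ n ^ R * m ^ i * (m * size V f r * ∏ others (size V f)))
        (length-applyUpTo _ j) (deleted-star V (length-vertices n) r∈ L others f F perm B fr leaf))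

    |M| : length M ≡ s
    |M| = length-applyUpTo _ s

    c = s + j
    T₀ = τ id (2 + c) F
    T₁ = τ f₁ (1 + c) F
    T₂ = τ f₂ (1 + c) F
    T₃ = τ f₃ c F
    X = τ id (2 + c) E
    P = n ^ s * m ^ j

    -- The four cases contract nothing, {1, n}, {r, n}, or both. The centre size and the product of
    -- the other sizes are (1, 1), (1, 2), (2, 1), (3, 1), and `R` drops by one per contraction.
    eq₀ : n * m * T₀ + n ^ (2 + s) * m ^ j * (j * 1) ≡ n ^ (2 + s) * m ^ j * (m * 1 * 1)
    eq₀ = evaluate id (n ∷ 1 ∷ M) blocks₀ refl (λ l∈ → refl , size-id n (L⊆ l∈)) (cong (_+_ 2) |M|) (size-id n r∈)
      (∏-ones (n ∷ 1 ∷ M) (λ { (here refl) → size-id n n∈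
          ; (there (here refl)) → size-id n 1∈ ; (there (there v∈)) → size-id n (M⊆ v∈) }))

    eq₁ : n * m * T₁ + n ^ (1 + s) * m ^ j * (j * 2) ≡ n ^ (1 + s) * m ^ j * (m * 1 * 2)
    eq₁ = evaluate f₁ (1 ∷ M) blocks₁ f₁r (λ l∈ → relabel-other 1 (L≢n l∈) , size₁-other (L⊆ l∈) (L≢1 l∈) (L≢n l∈))
      (cong suc |M|) (size₁-other r∈ (λ ()) r≢n)
      (cong₂ _*_ size₁-1 (∏-ones M (λ v∈ → size₁-other (M⊆ v∈) (M≢1 v∈) (M≢n v∈))))

    eq₂ : n * m * T₂ + n ^ (1 + s) * m ^ j * (j * 1) ≡ n ^ (1 + s) * m ^ j * (m * 2 * 1)
    eq₂ = evaluate f₂ (1 ∷ M) blocks₂ (relabel-source r n)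
        (λ l∈ → relabel-other r (L≢n l∈) , size₂-other (L⊆ l∈) (L≢r l∈) (L≢n l∈))
      (cong suc |M|) size₂-r
      (cong₂ _*_ (size₂-other 1∈ (λ ()) (λ ())) (∏-ones M (λ v∈ → size₂-other (M⊆ v∈) (M≢r v∈) (M≢n v∈))))

    eq₃ : n * m * T₃ + n ^ s * m ^ j * (j * 1) ≡ n ^ s * m ^ j * (m * 3 * 1)
    eq₃ = evaluate f₃ M blocks₃ (trans (relabel-source (f₁ r) (f₁ n)) f₁r)
      (λ l∈ → trans (relabel-other (f₁ r) (λ eq → L≢1 l∈ (trans (sym (f₁l l∈)) (trans eq f₁n)))) (f₁l l∈) ,
              size₃-other (L⊆ l∈) (L≢1 l∈) (L≢r l∈) (L≢n l∈))
      |M| size₃-r (∏-ones M (λ v∈ → size₃-other (M⊆ v∈) (M≢1 v∈) (M≢r v∈) (M≢n v∈)))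
      where
      f₁l : ∀ {l} → l ∈ L → f₁ l ≡ l
      f₁l l∈ = relabel-other 1 (L≢n l∈)

    inclusion–exclusion : X + T₁ + T₂ ≡ T₀ + T₃
    inclusion–exclusion = τ-without-pair id c e₁ e₂ E (λ ()) r≢n ¬joined₃

  -- Divided by `P`, the four cases combine to n²(m - j) - 2n(m - j) - n(2m - j) + (3m - j); the
  -- negative terms stand on the left.
  numUprooted-equation :
    n * m * numUprooted n r + P * (j + 4 * (n * m) + n * n * j) ≡ P * (n * n * m + 3 * m + 3 * (n * j))
  numUprooted-equation = trans (cong (λ x → n * m * x + P * (j + 4 * (n * m) + n * n * j)) X≡)
    (+-cancelʳ-≡ (l₁ + l₂) _ _ (begin
    n * m * X + P * (j + 4 * (n * m) + n * n * j) + (l₁ + l₂)     ≡⟨ r₁ n m j (n ^ s) (m ^ j) X T₁ T₂ ⟩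
    n * m * (X + T₁ + T₂) + (b₀ + b₃) + P * (4 * (n * m) + 3 * (n * j))
      ≡⟨ cong (λ t → n * m * t + (b₀ + b₃) + P * (4 * (n * m) + 3 * (n * j))) inclusion–exclusion ⟩
    n * m * (T₀ + T₃) + (b₀ + b₃) + P * (4 * (n * m) + 3 * (n * j))
      ≡⟨ r₂ (n * m) T₀ T₃ b₀ b₃ (P * (4 * (n * m) + 3 * (n * j))) ⟩
    n * m * T₀ + b₀ + (n * m * T₃ + b₃) + P * (4 * (n * m) + 3 * (n * j))
      ≡⟨ cong₂ (λ x y → x + y + P * (4 * (n * m) + 3 * (n * j))) eq₀ eq₃ ⟩
    n ^ (2 + s) * m ^ j * (m * 1 * 1) + P * (m * 3 * 1) + P * (4 * (n * m) + 3 * (n * j))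
      ≡⟨ r₃ n m j (n ^ s) (m ^ j) ⟩
    P * (n * n * m + 3 * m + 3 * (n * j)) + (n ^ (1 + s) * m ^ j * (m * 1 * 2) + n ^ (1 + s) * m ^ j * (m * 2 * 1))
      ≡⟨ cong (_+_ (P * (n * n * m + 3 * m + 3 * (n * j)))) (cong₂ _+_ eq₁ eq₂) ⟨
    P * (n * n * m + 3 * m + 3 * (n * j)) + (l₁ + l₂) ∎))
    where
    open ≡-Reasoning
    X≡ : numUprooted n r ≡ X
    X≡ = trans (numUprooted≡τ n r (s≤s z≤n)) (cong (λ i → τ id (2 + i) E) (+-comm j s))
    l₁ = n * m * T₁ + n ^ (1 + s) * m ^ j * (j * 2)
    l₂ = n * m * T₂ + n ^ (1 + s) * m ^ j * (j * 1)
    b₀ = n ^ (2 + s) * m ^ j * (j * 1)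
    b₃ = P * (j * 1)
    r₁ : ∀ n m j a b X T₁ T₂ →
      n * m * X + a * b * (j + 4 * (n * m) + n * n * j)
          + (n * m * T₁ + n * a * b * (j * 2) + (n * m * T₂ + n * a * b * (j * 1)))
      ≡ n * m * (X + T₁ + T₂) + (n * (n * a) * b * (j * 1) + a * b * (j * 1)) + a * b * (4 * (n * m) + 3 * (n * j))
    r₁ = solve-∀
    r₂ : ∀ k x y b d z → k * (x + y) + (b + d) + z ≡ k * x + b + (k * y + d) + z
    r₂ = solve-∀
    r₃ : ∀ n m j a b → n * (n * a) * b * (m * 1 * 1) + a * b * (m * 3 * 1) + a * b * (4 * (n * m) + 3 * (n * j))
      ≡ a * b * (n * n * m + 3 * m + 3 * (n * j)) + (n * a * b * (m * 1 * 2) + n * a * b * (m * 2 * 1))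
    r₃ = solve-∀

-- From natural numbers to rationals

-- In ℚ the fractions are reduced; among unnormalised rationals equality is cross multiplication,
-- and there the hypothesis applies directly.
clear-denominator : ∀ d .{{_ : NonZero d}} (x p b c : ℤ) → x ℤ.* + d ≡ p ℤ.* (b ℤ.* + d ℤ.+ c) →
  x ℚ./ 1 ≡ (p ℚ./ 1) ℚ.* ((b ℚ./ 1) ℚ.+ (c ℚ./ d))
clear-denominator (suc d) x p b c eq = ℚ.toℚᵘ-injective (begin
  ℚ.toℚᵘ (x ℚ./ 1)                                               ≈⟨ ℚ.toℚᵘ-fromℚᵘ (mkℚᵘ x 0) ⟩
  mkℚᵘ x 0
    ≈⟨ *≡* (trans (cong (λ e → x ℤ.* + suc e) (trans (+-identityʳ (d + 0)) (+-identityʳ d)))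
        (trans eq (ring p b (+ suc d) c))) ⟩
  mkℚᵘ p 0 ℚᵘ.* (mkℚᵘ b 0 ℚᵘ.+ mkℚᵘ c d)
    ≈⟨ ℚᵘ.*-cong (ℚ.toℚᵘ-fromℚᵘ (mkℚᵘ p 0)) (ℚᵘ.+-cong (ℚ.toℚᵘ-fromℚᵘ (mkℚᵘ b 0)) (ℚ.toℚᵘ-fromℚᵘ (mkℚᵘ c d))) ⟨
  ℚ.toℚᵘ (p ℚ./ 1) ℚᵘ.* (ℚ.toℚᵘ (b ℚ./ 1) ℚᵘ.+ ℚ.toℚᵘ (c ℚ./ suc d))
    ≈⟨ ℚᵘ.*-congˡ {ℚ.toℚᵘ (p ℚ./ 1)} (ℚ.toℚᵘ-homo-+ (b ℚ./ 1) (c ℚ./ suc d)) ⟨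
  ℚ.toℚᵘ (p ℚ./ 1) ℚᵘ.* ℚ.toℚᵘ ((b ℚ./ 1) ℚ.+ (c ℚ./ suc d))     ≈⟨ ℚ.toℚᵘ-homo-* (p ℚ./ 1) _ ⟨
  ℚ.toℚᵘ ((p ℚ./ 1) ℚ.* ((b ℚ./ 1) ℚ.+ (c ℚ./ suc d)))           ∎)
  where
  open ℚᵘ.≃-Reasoning
  ring : ∀ p b d c → p ℤ.* (b ℤ.* d ℤ.+ c) ≡ p ℤ.* (b ℤ.* d ℤ.+ c ℤ.* + 1) ℤ.* + 1
  ring = ℤ-solver.solve-∀

-- The target contains n - 3 - k, which is -1 for k = n - 2, so the terms can be regrouped in this
-- form only over ℤ.
pass-to-ℤ : ∀ m j x p → let n = suc m ; k = suc j in
  n * m * x + p * (j + 4 * (n * m) + n * n * j) ≡ p * (n * n * m + 3 * m + 3 * (n * j)) →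
  + x ℤ.* + (n * m) ≡ + p ℤ.* ((+ n ℤ.- + 3 ℤ.- + k) ℤ.* + (n * m) ℤ.+ (+ 2 ℤ.* + n ℤ.* + k ℤ.+ + n ℤ.- + k ℤ.- + 2))
pass-to-ℤ m j x p eq = begin
  + x ℤ.* + (n * m)                      ≡⟨ cong (ℤ._*_ (+ x)) (ℤ.pos-* n m) ⟩
  + x ℤ.* (+ n ℤ.* + m)                  ≡⟨ insert (+ n) (+ m) (+ x) (+ p ℤ.* a) ⟩
  + n ℤ.* + m ℤ.* + x ℤ.+ + p ℤ.* a ℤ.- + p ℤ.* a
    ≡⟨ cong (ℤ._- (+ p ℤ.* a)) (trans (sym lhs) (trans (cong +_ eq) rhs)) ⟩
  + p ℤ.* b ℤ.- + p ℤ.* a                ≡⟨ ring (+ m) (+ j) (+ p) ⟩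
  + p ℤ.* ((+ n ℤ.- + 3 ℤ.- + k) ℤ.* (+ n ℤ.* + m) ℤ.+ c)
    ≡⟨ cong (λ q → + p ℤ.* ((+ n ℤ.- + 3 ℤ.- + k) ℤ.* q ℤ.+ c)) (ℤ.pos-* n m) ⟨
  + p ℤ.* ((+ n ℤ.- + 3 ℤ.- + k) ℤ.* + (n * m) ℤ.+ c) ∎
  where
  open ≡-Reasoning
  n = suc m
  k = suc j
  a = + j ℤ.+ + 4 ℤ.* (+ n ℤ.* + m) ℤ.+ + n ℤ.* + n ℤ.* + j
  b = + n ℤ.* + n ℤ.* + m ℤ.+ + 3 ℤ.* + m ℤ.+ + 3 ℤ.* (+ n ℤ.* + j)
  c = + 2 ℤ.* + n ℤ.* + k ℤ.+ + n ℤ.- + k ℤ.- + 2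

  pos-*³ : ∀ x y z → + (x * y * z) ≡ + x ℤ.* + y ℤ.* + z
  pos-*³ x y z = trans (ℤ.pos-* (x * y) z) (cong (ℤ._* + z) (ℤ.pos-* x y))
  pos-*³′ : ∀ x y z → + (x * (y * z)) ≡ + x ℤ.* (+ y ℤ.* + z)
  pos-*³′ x y z = trans (ℤ.pos-* x (y * z)) (cong (ℤ._*_ (+ x)) (ℤ.pos-* y z))

  lhs : + (n * m * x + p * (j + 4 * (n * m) + n * n * j)) ≡ + n ℤ.* + m ℤ.* + x ℤ.+ + p ℤ.* a
  lhs = cong₂ ℤ._+_ (pos-*³ n m x) (trans (ℤ.pos-* p (j + 4 * (n * m) + n * n * j))
    (cong (ℤ._*_ (+ p)) (cong₂ ℤ._+_ (cong (ℤ._+_ (+ j)) (pos-*³′ 4 n m)) (pos-*³ n n j))))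
  rhs : + (p * (n * n * m + 3 * m + 3 * (n * j))) ≡ + p ℤ.* b
  rhs = trans (ℤ.pos-* p (n * n * m + 3 * m + 3 * (n * j)))
    (cong (ℤ._*_ (+ p)) (cong₂ ℤ._+_ (cong₂ ℤ._+_ (pos-*³ n n m) (ℤ.pos-* 3 m)) (pos-*³′ 3 n j)))

  insert : ∀ n m x t → x ℤ.* (n ℤ.* m) ≡ n ℤ.* m ℤ.* x ℤ.+ t ℤ.- t
  insert = ℤ-solver.solve-∀
  ring : ∀ m j p → let n = + 1 ℤ.+ m ; k = + 1 ℤ.+ j in
    p ℤ.* (n ℤ.* n ℤ.* m ℤ.+ + 3 ℤ.* m ℤ.+ + 3 ℤ.* (n ℤ.* j)) ℤ.- p ℤ.* (j ℤ.+ + 4 ℤ.* (n ℤ.* m) ℤ.+ n ℤ.* n ℤ.* j)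
      ≡ p ℤ.* ((n ℤ.- + 3 ℤ.- k) ℤ.* (n ℤ.* m) ℤ.+ (+ 2 ℤ.* n ℤ.* k ℤ.+ n ℤ.- k ℤ.- + 2))
  ring = ℤ-solver.solve-∀

theorem5p1 : (n : ℕ) → (h : 3 ≤ n) →
  (numUprooted n n ≡ n ^ (n ∸ 3) * (n ∸ 2))
  × ((k : ℕ) → 1 ≤ k → k ≤ n ∸ 2 →
      ((+ numUprooted n (n ∸ k)) ℚ./ 1)
        ≡ ((+ (n ^ (n ∸ 2 ∸ k) * (n ∸ 1) ^ (k ∸ 1))) ℚ./ 1)
          ℚ.* (((+ n ℤ.- + 3 ℤ.- + k) ℚ./ 1)
            ℚ.+ ℚ._/_ (+ 2 ℤ.* + n ℤ.* + k ℤ.+ + n ℤ.- + k ℤ.- + 2) (n * (n ∸ 1)) {{denomNonZero h}}))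
theorem5p1 (suc (suc (suc t))) h = numUprooted-top t , lower
  where
  lower : ∀ k → 1 ≤ k → k ≤ suc t → _
  -- With k = j + 1 and s = t - j, both r = n - k = 2 + s and the exponent n - 2 - k = s become free
  -- of subtraction.
  lower (suc j) _ (s≤s j≤t) with s , refl ← m≤n⇒∃[o]m+o≡n j≤t = subst₂
    (λ r e → + numUprooted n r ℚ./ 1 ≡ (+ (n ^ e * m ^ j) ℚ./ 1) ℚ.*
      (((+ n ℤ.- + 3 ℤ.- + suc j) ℚ./ 1) ℚ.+
        ((+ 2 ℤ.* + n ℤ.* + suc j ℤ.+ + n ℤ.- + suc j ℤ.- + 2) ℚ./ (n * m))))
    (sym (trans (cong (_∸ j) (trans (cong (_+_ 2) (+-comm j s)) (+-comm (2 + s) j))) (m+n∸m≡n j (2 + s))))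
    (sym (m+n∸m≡n j s))
    (clear-denominator (n * m) (+ numUprooted n (2 + s)) (+ (n ^ s * m ^ j)) (+ n ℤ.- + 3 ℤ.- + suc j)
      (+ 2 ℤ.* + n ℤ.* + suc j ℤ.+ + n ℤ.- + suc j ℤ.- + 2)
      (pass-to-ℤ m j (numUprooted n (2 + s)) (n ^ s * m ^ j) (numUprooted-equation j s)))
    where
    m = 2 + (j + s)
    n = suc m
theorem5p1 (suc (suc zero)) (s≤s (s≤s ()))
theorem5p1 (suc zero) (s≤s ())
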